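{- Every smooth pair $\tau=(w,x)$ (with $x\le w$ in $S_n$) is influential, i.e. $\mathcal{I}^w(X_\tau)=\Box$.
   Context: $S_n$ is the symmetric group on $\{1,\dots,n\}$ with Bruhat order $\le$ and length $\ell$; $\Box=\{0,\dots,n\}^2$. For $w\in S_n$ and $(i,j)\in\Box$, $\mathrm{rk}_w(i,j)=\#\{u\in\{1,\dots,i\}:w(u)\le j\}$. For $p=(i,j),p'=(i',j')\in\Box$ put $\mathrm{cr}(p,p')=\{(i,j'),(i',j)\}$, $D_w(p,p')=\mathrm{rk}_w(p)+\mathrm{rk}_w(p')-\mathrm{rk}_w(i,j')-\mathrm{rk}_w(i',j)$, and write $p\bowtie p'$ if $(i'-i)(j'-j)>0$. A pair is $\tau=(w,x)\in S_n\times S_n$ with $x\le w$; set $\mathrm{rk}_\tau=\mathrm{rk}_x-\mathrm{rk}_w\ge0$ and $X_\tau=\{p\in\Box:\mathrm{rk}_\tau(p)=0\}$. Let $R_\tau=\{t \text{ a transposition}: x<xt\le w\}$; $\tau$ is smooth if $\#R_\tau=\ell(w)-\ell(x)$ (equivalently $Y_x$ lies in the smooth locus of the Schubert variety $X_w$). For $A,B\subset\Box$, $C^w_A(B)=B\cup\{p\in\Box:\exists p'\in A,\ p\bowtie p',\ D_w(p,p')=0,\ \mathrm{cr}(p,p')\subset B\}$; with $A_0=A$, $A_k=C^w_A(A_{k-1})$, the influence set is $\mathcal{I}^w(A)=\bigcup_{k\ge0}A_k$. The pair $\tau$ is influential if $\mathcal{I}^w(X_\tau)=\Box$. -}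

module Defs where

open import Data.Nat using (ℕ; zero; suc; _+_; _<_)
open import Data.Nat.Properties using (_<?_)
open import Data.Integer using (ℤ; +_; _-_; _*_; 0ℤ) renaming (_<_ to _<ℤ_)
open import Data.Bool using (Bool; true; false; _∧_; if_then_else_)
open import Data.Fin using (Fin; toℕ) renaming (zero to fzero; suc to fsuc)
open import Data.Fin.Permutation using (Permutation′; _⟨$⟩ʳ_; _∘ₚ_; transpose; _≈_)
open import Data.Product using (Σ; ∃; _×_; _,_)
open import Data.Sum using (_⊎_)
open import Data.List using (List; length)
open import Data.List.Membership.Propositional using (_∈_)
open import Data.List.Relation.Unary.Unique.Propositional using (Unique)
open import Function using (_⇔_)
open import Relation.Nullary using (¬_; does)
open import Relation.Binary.PropositionalEquality using (_≡_)

-- S_n : permutations of {1,…,n}, encoded 0-based as bijections of Fin n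
-- (position u ↔ u+1, value w ⟨$⟩ʳ u ↔ w(u+1)).

Perm : ℕ → Set
Perm n = Permutation′ n

count : ∀ {n} → (Fin n → Bool) → ℕ
count {zero}  f = 0
count {suc n} f = (if f fzero then 1 else 0) + count (λ u → f (fsuc u))

sumFin : ∀ {n} → (Fin n → ℕ) → ℕ
sumFin {zero}  f = 0
sumFin {suc n} f = f fzero + sumFin (λ u → f (fsuc u))

len : ∀ {n} → Perm n → ℕ
len {n} w = sumFin {n} (λ a → count {n} (λ b →
  does (toℕ a <? toℕ b) ∧ does (toℕ (w ⟨$⟩ʳ b) <? toℕ (w ⟨$⟩ʳ a))))

-- w t  (first t, then w), t the transposition of a and b
_·t[_,_] : ∀ {n} → Perm n → Fin n → Fin n → Perm n
w ·t[ a , b ] = transpose a b ∘ₚ w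

data _≤B_ {n : ℕ} : Perm n → Perm n → Set where
  ≤B-refl : ∀ {x y} → x ≈ y → x ≤B y
  ≤B-step : ∀ {x y z} (a b : Fin n) → x ≤B y →
            len y < len (y ·t[ a , b ]) → z ≈ (y ·t[ a , b ]) → x ≤B z

_<B_ : ∀ {n} → Perm n → Perm n → Set
x <B y = x ≤B y × ¬ (x ≈ y)

Box : ℕ → Set
Box n = Fin (suc n) × Fin (suc n)

-- rk_w(i,j) = #{u ∈ {1..i} : w(u) ≤ j}   (0-based: u < i, w u < j)
rk : ∀ {n} → Perm n → ℕ → ℕ → ℕ
rk w i j = count (λ u → does (toℕ u <? i) ∧ does (toℕ (w ⟨$⟩ʳ u) <? j))

rkB : ∀ {n} → Perm n → Box n → ℕ
rkB w (i , j) = rk w (toℕ i) (toℕ j)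

D : ∀ {n} → Perm n → Box n → Box n → ℤ
D w (i , j) (i' , j') =
  ((+ rkB w (i , j)) Data.Integer.+ (+ rkB w (i' , j')))
    - (+ rkB w (i , j')) - (+ rkB w (i' , j))

_⋈_ : ∀ {n} → Box n → Box n → Set
(i , j) ⋈ (i' , j') =
  0ℤ <ℤ ((+ toℕ i' - + toℕ i) * (+ toℕ j' - + toℕ j))

Step : ∀ {n} → Perm n → (A B : Box n → Set) → Box n → Set
Step {n} w A B (i , j) =
  B (i , j) ⊎
  (Σ (Box n) λ { (i' , j') →
      A (i' , j') × ((i , j) ⋈ (i' , j')) × (D w (i , j) (i' , j') ≡ 0ℤ)
      × B (i , j') × B (i' , j) })

Iter : ∀ {n} → Perm n → (A : Box n → Set) → ℕ → Box n → Set
Iter w A zero    = A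
Iter w A (suc k) = Step w A (Iter w A k)

Influence : ∀ {n} → Perm n → (A : Box n → Set) → Box n → Set
Influence w A p = ∃ λ k → Iter w A k p

X : ∀ {n} → Perm n → Perm n → Box n → Set
X w x p = (+ rkB x p) - (+ rkB w p) ≡ 0ℤ

-- R_τ, transpositions t = (a b) encoded by a < b
InR : ∀ {n} → Perm n → Perm n → Fin n × Fin n → Set
InR w x (a , b) = (toℕ a < toℕ b) × (x <B (x ·t[ a , b ])) × ((x ·t[ a , b ]) ≤B w)

HasCard : {T : Set} → (T → Set) → ℕ → Set
HasCard {T} P k = Σ (List T) λ L → Unique L × (∀ t → (t ∈ L) ⇔ P t) × (length L ≡ k)

Smooth : ∀ {n} → Perm n → Perm n → Set
Smooth w x = Σ ℕ λ k → HasCard (InR w x) k × ((+ k) ≡ (+ len w) - (+ len x))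

Influential : ∀ {n} → Perm n → Perm n → Set
Influential {n} w x = (p : Box n) → Influence w (X w x) p

{-# OPTIONS --safe #-}
module Submission where

-- Write f = rk_x − rk_w and let V be its zero set, X_τ.
--
-- Counting.  For a set Q of boxes call z admissible if rk_z ≥ rk_w on Q.  By Gasharov's injection the
-- number of reflections t with y t admissible does not grow when y moves up in the Bruhat order.  For
-- Q = □ this number is ℓ(w) at y = w; for Q = V it equals ℓ(x) + #R_τ at y = x.  If τ is smooth the
-- two agree, which forces every y obtained from x by exchanges whose rectangles avoid V to satisfy y ≤ w.
--
-- Exchanges.  Suppose some box is not influenced.  For such a box p = (i , j) compare, position by
-- position, the points of w in the lower left quadrant of p with the points of x there that are
-- separated from p by V.  If among the last t positions before i the former do not outnumber the
-- latter, then sweeping these positions shows that p would be influenced were (i − t , j) influenced,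
-- and that f(i − t , j) ≤ f(p).  The same holds in the upper right quadrant.  Hence p can be moved
-- horizontally to a place where w wins in both quadrants.  This survives every exchange of a point
-- left of p with a higher one right of p, and as long as it holds there is such an exchange whose
-- rectangle avoids V.  By the first part the process never leaves the interval below w, so it goes on
-- forever, which is absurd, since each exchange lowers Σ rk_y.

open import Data.Nat using (ℕ; zero; suc; _+_; _∸_; _*_; _≤_; _<_; z≤n; s≤s; z<s; _≤?_; _<?_; _≟_)
open import Data.Nat.Properties
open import Data.Bool using (Bool; _∧_; if_then_else_)
open import Data.Fin using (Fin; toℕ; fromℕ<) renaming (zero to fzero; suc to fsuc)
import Data.Fin.Properties as Fin
open import Data.Fin.Permutation using (_⟨$⟩ʳ_; _≈_)
import Data.Fin.Permutation.Components as Components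
open import Data.Product using (Σ; ∃; _×_; _,_; proj₁; proj₂)
open import Data.Sum using (_⊎_; inj₁; inj₂)
open import Data.Empty using (⊥; ⊥-elim)
open import Data.Unit using (⊤; tt)
import Data.Integer as ℤ
import Data.Integer.Properties as ℤ
open import Data.List using (List; []; _∷_; length)
open import Data.List.Membership.Propositional using (_∈_)
open import Data.List.Relation.Unary.Any using (here; there)
open import Function using (case_of_; _∘_; Injection; Equivalence)
open import Function.Properties.Inverse using (↔⇒↣)
open import Relation.Nullary using (¬_; Dec; yes; no; does; ¬?; _→-dec_; _×-dec_; _⊎-dec_)
open import Relation.Nullary.Decidable as Decidable using (dec-true; dec-false; decidable-stable)
open import Relation.Binary using (tri<; tri≈; tri>)
open import Relation.Binary.PropositionalEquality using (_≡_; _≢_; refl; sym; trans; cong; cong₂; subst; subst₂; module ≡-Reasoning)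
open import Defs

-- Sums and ranks of functions on ℕ

𝟙 : {P : Set} → Dec P → ℕ
𝟙 (yes _) = 1
𝟙 (no _)  = 0

𝟙-mono : {P Q : Set} (p : Dec P) (q : Dec Q) → (P → Q) → 𝟙 p ≤ 𝟙 q
𝟙-mono (yes p) (yes q) h = ≤-refl
𝟙-mono (yes p) (no ¬q) h = ⊥-elim (¬q (h p))
𝟙-mono (no ¬p) q       h = z≤n

𝟙-cong : {P Q : Set} (p : Dec P) (q : Dec Q) → (P → Q) → (Q → P) → 𝟙 p ≡ 𝟙 q
𝟙-cong p q f g = ≤-antisym (𝟙-mono p q f) (𝟙-mono q p g)

𝟙≤1 : {P : Set} (p : Dec P) → 𝟙 p ≤ 1
𝟙≤1 (yes _) = ≤-refl
𝟙≤1 (no _)  = z≤n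

𝟙-yes : {P : Set} (p : Dec P) → P → 𝟙 p ≡ 1
𝟙-yes (yes _) _ = refl
𝟙-yes (no ¬p) p = ⊥-elim (¬p p)

𝟙-no : {P : Set} (p : Dec P) → ¬ P → 𝟙 p ≡ 0
𝟙-no (yes p) ¬p = ⊥-elim (¬p p)
𝟙-no (no _)  _  = refl

𝟙-pos : {P : Set} (p : Dec P) → 1 ≤ 𝟙 p → P
𝟙-pos (yes p) _ = p

lt : ℕ → ℕ → ℕ
lt a b = 𝟙 (a <? b)

lt-yes : ∀ {a b} → a < b → lt a b ≡ 1
lt-yes = 𝟙-yes (_ <? _)

lt-no : ∀ {a b} → b ≤ a → lt a b ≡ 0
lt-no h = 𝟙-no (_ <? _) (≤⇒≯ h)

lt-mono : ∀ {a b c d} → (a < b → c < d) → lt a b ≤ lt c d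
lt-mono = 𝟙-mono (_ <? _) (_ <? _)

lt-cong : ∀ {a b c d} → (a < b → c < d) → (c < d → a < b) → lt a b ≡ lt c d
lt-cong = 𝟙-cong (_ <? _) (_ <? _)

sumTo : ℕ → (ℕ → ℕ) → ℕ
sumTo zero    f = 0
sumTo (suc n) f = sumTo n f + f n

sumTo-mono : ∀ n {f g} → (∀ k → k < n → f k ≤ g k) → sumTo n f ≤ sumTo n g
sumTo-mono zero    h = z≤n
sumTo-mono (suc n) h = +-mono-≤ (sumTo-mono n λ k k<n → h k (m<n⇒m<1+n k<n)) (h n ≤-refl)

sumTo-cong : ∀ n {f g} → (∀ k → k < n → f k ≡ g k) → sumTo n f ≡ sumTo n g
sumTo-cong zero    h = refl
sumTo-cong (suc n) h = cong₂ _+_ (sumTo-cong n λ k k<n → h k (m<n⇒m<1+n k<n)) (h n ≤-refl)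

sumTo-strict : ∀ n {f g} → (∀ k → k < n → f k ≤ g k) → ∀ k → k < n → f k < g k → sumTo n f < sumTo n g
sumTo-strict (suc n) h k k<1+n fk<gk with k ≟ n
... | yes refl = +-mono-≤-< (sumTo-mono n λ j j<n → h j (m<n⇒m<1+n j<n)) fk<gk
... | no k≢n   = +-mono-<-≤ (sumTo-strict n (λ j j<n → h j (m<n⇒m<1+n j<n)) k (≤∧≢⇒< (≤-pred k<1+n) k≢n) fk<gk) (h n ≤-refl)

+-interchange : ∀ a b c d → (a + b) + (c + d) ≡ (a + c) + (b + d)
+-interchange a b c d = begin
  (a + b) + (c + d) ≡⟨ +-assoc a b (c + d) ⟩
  a + (b + (c + d)) ≡⟨ cong (a +_) (sym (+-assoc b c d)) ⟩
  a + ((b + c) + d) ≡⟨ cong (λ e → a + (e + d)) (+-comm b c) ⟩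
  a + ((c + b) + d) ≡⟨ cong (a +_) (+-assoc c b d) ⟩
  a + (c + (b + d)) ≡⟨ sym (+-assoc a c (b + d)) ⟩
  (a + c) + (b + d) ∎
  where open ≡-Reasoning

swap₃ : ∀ p q r → (p + q) + r ≡ (p + r) + q
swap₃ p q r = trans (+-assoc p q r) (trans (cong (p +_) (+-comm q r)) (sym (+-assoc p r q)))

sumTo-+ : ∀ n f g → sumTo n (λ k → f k + g k) ≡ sumTo n f + sumTo n g
sumTo-+ zero    f g = refl
sumTo-+ (suc n) f g = trans (cong (_+ (f n + g n)) (sumTo-+ n f g)) (+-interchange (sumTo n f) (sumTo n g) (f n) (g n))

sumTo-const : ∀ n c → sumTo n (λ _ → c) ≡ n * c
sumTo-const zero    c = refl
sumTo-const (suc n) c = trans (cong (_+ c) (sumTo-const n c)) (+-comm (n * c) c)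

sumTo-zero : ∀ n {f} → (∀ k → k < n → f k ≡ 0) → sumTo n f ≡ 0
sumTo-zero n h = trans (sumTo-cong n h) (trans (sumTo-const n 0) (*-zeroʳ n))

sumTo-front : ∀ n f → sumTo (suc n) f ≡ f 0 + sumTo n (λ k → f (suc k))
sumTo-front zero    f = sym (+-identityʳ (f 0))
sumTo-front (suc n) f = trans (cong (_+ f (suc n)) (sumTo-front n f)) (+-assoc (f 0) _ _)

sumTo-swap : ∀ n m (f : ℕ → ℕ → ℕ) → sumTo n (λ i → sumTo m (f i)) ≡ sumTo m (λ j → sumTo n (λ i → f i j))
sumTo-swap n zero    f = sumTo-zero n λ _ _ → refl
sumTo-swap n (suc m) f = trans (sumTo-+ n (λ i → sumTo m (f i)) (λ i → f i m)) (cong (_+ sumTo n (λ i → f i m)) (sumTo-swap n m f))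

erase : ℕ → (ℕ → ℕ) → ℕ → ℕ
erase a f k with k ≟ a
... | yes _ = 0
... | no _  = f k

erase-eq : ∀ a f → erase a f a ≡ 0
erase-eq a f with a ≟ a
... | yes _ = refl
... | no ¬p = ⊥-elim (¬p refl)

erase-neq : ∀ {a} f {k} → k ≢ a → erase a f k ≡ f k
erase-neq {a} f {k} h with k ≟ a
... | yes p = ⊥-elim (h p)
... | no _  = refl

sumTo-pull : ∀ n a f → a < n → sumTo n f ≡ f a + sumTo n (erase a f)
sumTo-pull (suc n) a f a<1+n with a ≟ n
... | yes refl = begin
  sumTo n f + f n             ≡⟨ +-comm _ (f n) ⟩
  f n + sumTo n f             ≡⟨ cong (f n +_) (sumTo-cong n λ k k<n → sym (erase-neq f (<⇒≢ k<n))) ⟩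
  f n + sumTo n (erase n f)   ≡⟨ cong (f n +_) (sym (+-identityʳ _)) ⟩
  f n + (sumTo n (erase n f) + 0) ≡⟨ cong (λ e → f n + (sumTo n (erase n f) + e)) (sym (erase-eq n f)) ⟩
  f n + (sumTo n (erase n f) + erase n f n) ∎
  where open ≡-Reasoning
... | no a≢n = begin
  sumTo n f + f n ≡⟨ cong₂ _+_ (sumTo-pull n a f (≤∧≢⇒< (≤-pred a<1+n) a≢n)) (sym (erase-neq f λ n≡a → a≢n (sym n≡a))) ⟩
  (f a + sumTo n (erase a f)) + erase a f n ≡⟨ +-assoc (f a) _ _ ⟩
  f a + (sumTo n (erase a f) + erase a f n) ∎
  where open ≡-Reasoning

sumTo-pull₂ : ∀ n a b f → a ≢ b → a < n → b < n → sumTo n f ≡ (f a + f b) + sumTo n (erase b (erase a f))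
sumTo-pull₂ n a b f a≢b a<n b<n = begin
  sumTo n f ≡⟨ sumTo-pull n a f a<n ⟩
  f a + sumTo n (erase a f) ≡⟨ cong (f a +_) (sumTo-pull n b (erase a f) b<n) ⟩
  f a + (erase a f b + sumTo n (erase b (erase a f))) ≡⟨ cong (λ e → f a + (e + sumTo n (erase b (erase a f)))) (erase-neq f λ b≡a → a≢b (sym b≡a)) ⟩
  f a + (f b + sumTo n (erase b (erase a f))) ≡⟨ sym (+-assoc (f a) (f b) _) ⟩
  (f a + f b) + sumTo n (erase b (erase a f)) ∎
  where open ≡-Reasoning

erase-mono : ∀ a {f g} k → (k ≢ a → f k ≤ g k) → erase a f k ≤ erase a g k
erase-mono a k h with k ≟ a
... | yes _ = z≤n
... | no ¬p = h ¬p

-- Termwise comparison can fail at the two positions that an exchange touches, so their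
-- contributions are compared jointly. The slack `k` serves strict inequalities.
sumTo-mono₂ : ∀ k n a b {f g} → a ≢ b → a < n → b < n → (∀ c → c < n → c ≢ a → c ≢ b → f c ≤ g c)
            → k + (f a + f b) ≤ g a + g b → k + sumTo n f ≤ sumTo n g
sumTo-mono₂ k n a b {f} {g} a≢b a<n b<n h hab = begin
  k + sumTo n f                         ≡⟨ cong (k +_) (sumTo-pull₂ n a b f a≢b a<n b<n) ⟩
  k + ((f a + f b) + sumTo n (erase b (erase a f))) ≡⟨ sym (+-assoc k _ _) ⟩
  (k + (f a + f b)) + sumTo n (erase b (erase a f)) ≤⟨ +-mono-≤ hab (sumTo-mono n λ c c<n → erase-mono b c λ c≢b → erase-mono a c λ c≢a → h c c<n c≢a c≢b) ⟩
  (g a + g b) + sumTo n (erase b (erase a g)) ≡⟨ sym (sumTo-pull₂ n a b g a≢b a<n b<n) ⟩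
  sumTo n g ∎
  where open ≤-Reasoning

sw : ℕ → ℕ → (ℕ → ℕ) → ℕ → ℕ
sw a b y k with k ≟ a
... | yes _ = y b
... | no _ with k ≟ b
...   | yes _ = y a
...   | no _  = y k

sw-l : ∀ a b y → sw a b y a ≡ y b
sw-l a b y with a ≟ a
... | yes _ = refl
... | no ¬p = ⊥-elim (¬p refl)

sw-r : ∀ a b y → sw a b y b ≡ y a
sw-r a b y with b ≟ a
... | yes b≡a = cong y b≡a
... | no _ with b ≟ b
...   | yes _ = refl
...   | no ¬p = ⊥-elim (¬p refl)

sw-o : ∀ a b y {k} → k ≢ a → k ≢ b → sw a b y k ≡ y k
sw-o a b y {k} k≢a k≢b with k ≟ a
... | yes p = ⊥-elim (k≢a p)
... | no _ with k ≟ b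
...   | yes p = ⊥-elim (k≢b p)
...   | no _  = refl

sw-comm : ∀ a b y k → sw a b y k ≡ sw b a y k
sw-comm a b y k = case k ≟ a of λ
  { (yes refl) → trans (sw-l a b y) (sym (sw-r b a y))
  ; (no k≢a) → case k ≟ b of λ
    { (yes refl) → trans (sw-r a b y) (sym (sw-l b a y))
    ; (no k≢b) → trans (sw-o a b y k≢a k≢b) (sym (sw-o b a y k≢b k≢a)) } }

sw-id : ∀ a y k → sw a a y k ≡ y k
sw-id a y k with k ≟ a
... | yes p = cong y (sym p)
... | no _  with k ≟ a
...   | yes p = cong y (sym p)
...   | no _ = refl

rank : (ℕ → ℕ) → ℕ → ℕ → ℕ
rank y i j = sumTo i (λ c → lt (y c) j)

rank-cong : ∀ {y z} i j → (∀ c → c < i → y c ≡ z c) → rank y i j ≡ rank z i j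
rank-cong i j h = sumTo-cong i λ c c<i → cong (λ v → lt v j) (h c c<i)

rank-sw-≤ : ∀ a b y i j → i ≤ a → i ≤ b → rank (sw a b y) i j ≡ rank y i j
rank-sw-≤ a b y i j i≤a i≤b = rank-cong i j λ c c<i → sw-o a b y (<⇒≢ (<-≤-trans c<i i≤a)) (<⇒≢ (<-≤-trans c<i i≤b))

erase₂-sw : ∀ a b y j k → erase b (erase a (λ c → lt (sw a b y c) j)) k ≡ erase b (erase a (λ c → lt (y c) j)) k
erase₂-sw a b y j k with k ≟ b
... | yes _  = refl
... | no k≢b with k ≟ a
...   | yes _  = refl
...   | no k≢a = cong (λ v → lt v j) (sw-o a b y k≢a k≢b)

rank-sw-> : ∀ a b y i j → a < i → b < i → a ≢ b → rank (sw a b y) i j ≡ rank y i j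
rank-sw-> a b y i j a<i b<i a≢b = begin
  sumTo i f ≡⟨ sumTo-pull₂ i a b f a≢b a<i b<i ⟩
  (lt (sw a b y a) j + lt (sw a b y b) j) + sumTo i (erase b (erase a f)) ≡⟨ cong₂ _+_ (cong₂ _+_ (cong (λ v → lt v j) (sw-l a b y)) (cong (λ v → lt v j) (sw-r a b y))) (sumTo-cong i λ k _ → erase₂-sw a b y j k) ⟩
  (lt (y b) j + lt (y a) j) + sumTo i (erase b (erase a g)) ≡⟨ cong (_+ sumTo i (erase b (erase a g))) (+-comm (lt (y b) j) _) ⟩
  (lt (y a) j + lt (y b) j) + sumTo i (erase b (erase a g)) ≡⟨ sym (sumTo-pull₂ i a b g a≢b a<i b<i) ⟩
  sumTo i g ∎
  where
    open ≡-Reasoning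
    f g : ℕ → ℕ
    f c = lt (sw a b y c) j
    g c = lt (y c) j

-- The first `i` positions lose the value `y a` and receive `y b`. The additive form keeps truncated
-- subtraction out of everything that follows.
rank-sw-mid : ∀ a b y i j → a < i → i ≤ b → rank (sw a b y) i j + lt (y a) j ≡ rank y i j + lt (y b) j
rank-sw-mid a b y i j a<i i≤b = begin
  sumTo i f + lt (y a) j ≡⟨ cong (_+ lt (y a) j) (sumTo-pull i a f a<i) ⟩
  (lt (sw a b y a) j + sumTo i (erase a f)) + lt (y a) j ≡⟨ cong₂ (λ p q → (p + q) + lt (y a) j) (cong (λ v → lt v j) (sw-l a b y)) (sumTo-cong i eq) ⟩
  (lt (y b) j + sumTo i (erase a g)) + lt (y a) j ≡⟨ +-comm _ (lt (y a) j) ⟩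
  lt (y a) j + (lt (y b) j + sumTo i (erase a g)) ≡⟨ cong (lt (y a) j +_) (+-comm (lt (y b) j) _) ⟩
  lt (y a) j + (sumTo i (erase a g) + lt (y b) j) ≡⟨ sym (+-assoc (lt (y a) j) _ _) ⟩
  (lt (y a) j + sumTo i (erase a g)) + lt (y b) j ≡⟨ cong (_+ lt (y b) j) (sym (sumTo-pull i a g a<i)) ⟩
  sumTo i g + lt (y b) j ∎
  where
    open ≡-Reasoning
    f g : ℕ → ℕ
    f c = lt (sw a b y c) j
    g c = lt (y c) j
    eq : ∀ k → k < i → erase a f k ≡ erase a g k
    eq k k<i with k ≟ a
    ... | yes _  = refl
    ... | no k≢a = cong (λ v → lt v j) (sw-o a b y k≢a (<⇒≢ (<-≤-trans k<i i≤b)))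

rank-sw-le : ∀ {a b} y i j → a < b → y a ≤ y b → rank (sw a b y) i j ≤ rank y i j
rank-sw-le {a} {b} y i j a<b ya≤yb with i ≤? a
... | yes i≤a = ≤-reflexive (rank-sw-≤ a b y i j i≤a (≤-trans i≤a (<⇒≤ a<b)))
... | no i≰a with i ≤? b
...   | no i≰b  = ≤-reflexive (rank-sw-> a b y i j (≰⇒> i≰a) (≰⇒> i≰b) (<⇒≢ a<b))
...   | yes i≤b = +-cancelʳ-≤ (lt (y a) j) _ _ (begin
  rank (sw a b y) i j + lt (y a) j ≡⟨ rank-sw-mid a b y i j (≰⇒> i≰a) i≤b ⟩
  rank y i j + lt (y b) j ≤⟨ +-monoʳ-≤ (rank y i j) (lt-mono (≤-<-trans ya≤yb)) ⟩
  rank y i j + lt (y a) j ∎)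
  where open ≤-Reasoning

rank-sw-eq : ∀ {a b} y i j → a < b → y a < y b → ¬ (a < i × i ≤ b × y a < j × j ≤ y b) → rank (sw a b y) i j ≡ rank y i j
rank-sw-eq {a} {b} y i j a<b ya<yb out with i ≤? a
... | yes i≤a = rank-sw-≤ a b y i j i≤a (≤-trans i≤a (<⇒≤ a<b))
... | no i≰a with i ≤? b
...   | no i≰b  = rank-sw-> a b y i j (≰⇒> i≰a) (≰⇒> i≰b) (<⇒≢ a<b)
...   | yes i≤b = +-cancelʳ-≡ (lt (y a) j) _ _ (trans (rank-sw-mid a b y i j (≰⇒> i≰a) i≤b) (cong (rank y i j +_)
  (lt-cong (<-trans ya<yb) λ ya<j → ≰⇒> λ j≤yb → out (≰⇒> i≰a , i≤b , ya<j , j≤yb))))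

rank-sw-drop : ∀ {a b} y i j → a < i → i ≤ b → y a < j → j ≤ y b → suc (rank (sw a b y) i j) ≡ rank y i j
rank-sw-drop {a} {b} y i j a<i i≤b ya<j j≤yb = begin
  suc (rank (sw a b y) i j)        ≡⟨ +-comm 1 _ ⟩
  rank (sw a b y) i j + 1          ≡⟨ cong (rank (sw a b y) i j +_) (sym (lt-yes ya<j)) ⟩
  rank (sw a b y) i j + lt (y a) j ≡⟨ rank-sw-mid a b y i j a<i i≤b ⟩
  rank y i j + lt (y b) j          ≡⟨ cong (rank y i j +_) (lt-no j≤yb) ⟩
  rank y i j + 0                   ≡⟨ +-identityʳ _ ⟩
  rank y i j ∎
  where open ≡-Reasoning

-- Gasharov's injection

least : {P : ℕ → Set} → (∀ k → Dec (P k)) → ∀ n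
      → (∀ k → k < n → ¬ P k) ⊎ ∃ λ m → m < n × P m × (∀ k → k < m → ¬ P k)
least P? zero = inj₁ λ _ ()
least P? (suc n) with least P? n
... | inj₂ (m , m<n , pm , h) = inj₂ (m , m<n⇒m<1+n m<n , pm , h)
... | inj₁ none with P? n
...   | yes pn = inj₂ (n , ≤-refl , pn , none)
...   | no ¬pn = inj₁ λ k k<1+n → case k ≟ n of λ
  { (yes refl) → ¬pn ; (no k≢n) → none k (≤∧≢⇒< (≤-pred k<1+n) k≢n) }

𝟙-pair-par : {P₁ P₂ R₁ R₂ : Set} (p₁ : Dec P₁) (p₂ : Dec P₂) (r₁ : Dec R₁) (r₂ : Dec R₂)
           → (P₁ → R₁) → (P₂ → R₂) → 𝟙 p₁ + 𝟙 p₂ ≤ 𝟙 r₁ + 𝟙 r₂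
𝟙-pair-par p₁ p₂ r₁ r₂ f g = +-mono-≤ (𝟙-mono p₁ r₁ f) (𝟙-mono p₂ r₂ g)

-- Inclusion and exclusion: `𝟙 p₁ + 𝟙 p₂` counts the disjunction once and the conjunction once.
𝟙-pair-lat : {P₁ P₂ R₁ R₂ : Set} (p₁ : Dec P₁) (p₂ : Dec P₂) (r₁ : Dec R₁) (r₂ : Dec R₂)
           → (P₁ ⊎ P₂ → R₁) → (P₁ → P₂ → R₂) → 𝟙 p₁ + 𝟙 p₂ ≤ 𝟙 r₁ + 𝟙 r₂
𝟙-pair-lat (yes p) p₂ r₁ r₂ f g rewrite 𝟙-yes r₁ (f (inj₁ p)) = s≤s (𝟙-mono p₂ r₂ (g p))
𝟙-pair-lat (no _)  p₂ r₁ r₂ f g = ≤-trans (𝟙-mono p₂ r₁ (f ∘ inj₂)) (m≤m+n _ _)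

-- Products of transpositions supported on the three positions `a`, `b`, `c` are identified by their
-- values there, which replaces computing with nested `sw`.
Tri : (y : ℕ → ℕ) (a b c : ℕ) (F : ℕ → ℕ) (p q r : ℕ) → Set
Tri y a b c F p q r = F a ≡ p × F b ≡ q × F c ≡ r × (∀ k → k ≢ a → k ≢ b → k ≢ c → F k ≡ y k)

tri-unique : ∀ {y a b c F G p q r} → Tri y a b c F p q r → Tri y a b c G p q r → ∀ k → F k ≡ G k
tri-unique {a = a} {b} {c} (fa , fb , fc , fo) (ga , gb , gc , go) k = case k ≟ a of λ
  { (yes refl) → trans fa (sym ga)
  ; (no k≢a) → case k ≟ b of λ
    { (yes refl) → trans fb (sym gb)
    ; (no k≢b) → case k ≟ c of λ
      { (yes refl) → trans fc (sym gc)
      ; (no k≢c) → trans (fo k k≢a k≢b k≢c) (sym (go k k≢a k≢b k≢c)) } } }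

tri-base : ∀ {y a b c} → Tri y a b c y (y a) (y b) (y c)
tri-base = refl , refl , refl , λ _ _ _ _ → refl

tri-ab : ∀ {y a b c F p q r} → c ≢ a → c ≢ b → Tri y a b c F p q r → Tri y a b c (sw a b F) q p r
tri-ab {a = a} {b} {F = F} c≢a c≢b (fa , fb , fc , fo) =
  trans (sw-l a b F) fb , trans (sw-r a b F) fa , trans (sw-o a b F c≢a c≢b) fc ,
  λ k k≢a k≢b k≢c → trans (sw-o a b F k≢a k≢b) (fo k k≢a k≢b k≢c)

tri-ca : ∀ {y a b c F p q r} → a ≢ b → c ≢ b → Tri y a b c F p q r → Tri y a b c (sw c a F) r q p
tri-ca {a = a} {b} {c} {F} a≢b c≢b (fa , fb , fc , fo) =
  trans (sw-r c a F) fc , trans (sw-o c a F (c≢b ∘ sym) (a≢b ∘ sym)) fb , trans (sw-l c a F) fa ,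
  λ k k≢a k≢b k≢c → trans (sw-o c a F k≢c k≢a) (fo k k≢a k≢b k≢c)

tri-cb : ∀ {y a b c F p q r} → a ≢ b → c ≢ a → Tri y a b c F p q r → Tri y a b c (sw c b F) p r q
tri-cb {a = a} {b} {c} {F} a≢b c≢a (fa , fb , fc , fo) =
  trans (sw-o c b F (c≢a ∘ sym) a≢b) fa , trans (sw-r c b F) fc , trans (sw-l c b F) fb ,
  λ k k≢a k≢b k≢c → trans (sw-o c b F k≢c k≢b) (fo k k≢a k≢b k≢c)

tri-comm : ∀ {y a b c F p q r d e} → Tri y a b c (sw d e F) p q r → Tri y a b c (sw e d F) p q r
tri-comm {a = a} {b} {c} {F} {d = d} {e} (fa , fb , fc , fo) =
  trans (sw-comm e d F a) fa , trans (sw-comm e d F b) fb , trans (sw-comm e d F c) fc ,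
  λ k k≢a k≢b k≢c → trans (sw-comm e d F k) (fo k k≢a k≢b k≢c)

sw-disjoint : ∀ {a b c d} y → c ≢ a → c ≢ b → d ≢ a → d ≢ b → ∀ k → sw c d (sw a b y) k ≡ sw a b (sw c d y) k
sw-disjoint {a} {b} {c} {d} y c≢a c≢b d≢a d≢b k = case k ≟ a of λ
  { (yes refl) → trans (sw-o c d _ (c≢a ∘ sym) (d≢a ∘ sym)) (trans (sw-l a b y) (trans (sym (sw-o c d y (c≢b ∘ sym) (d≢b ∘ sym))) (sym (sw-l a b _))))
  ; (no k≢a) → case k ≟ b of λ
    { (yes refl) → trans (sw-o c d _ (c≢b ∘ sym) (d≢b ∘ sym)) (trans (sw-r a b y) (trans (sym (sw-o c d y (c≢a ∘ sym) (d≢a ∘ sym))) (sym (sw-r a b _))))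
    ; (no k≢b) → trans (other k k≢a k≢b) (sym (sw-o a b _ k≢a k≢b)) } }
  where
    other : ∀ k → k ≢ a → k ≢ b → sw c d (sw a b y) k ≡ sw c d y k
    other k k≢a k≢b = case k ≟ c of λ
      { (yes refl) → trans (sw-l c d _) (trans (sw-o a b y d≢a d≢b) (sym (sw-l c d y)))
      ; (no k≢c) → case k ≟ d of λ
        { (yes refl) → trans (sw-r c d _) (trans (sw-o a b y c≢a c≢b) (sym (sw-r c d y)))
        ; (no k≢d) → trans (sw-o c d _ k≢c k≢d) (trans (sw-o a b y k≢a k≢b) (sym (sw-o c d y k≢c k≢d))) } }

module Admissible (n : ℕ) (w : ℕ → ℕ) (Q : ℕ → ℕ → Set) (Q? : ∀ i j → Dec (Q i j)) where

  Adm : (ℕ → ℕ) → Set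
  Adm z = ∀ {i} → i < suc n → ∀ {j} → j < suc n → Q i j → rank w i j ≤ rank z i j

  adm? : ∀ z → Dec (Adm z)
  adm? z = allUpTo? (λ i → allUpTo? (λ j → Q? i j →-dec (rank w i j ≤? rank z i j)) (suc n)) (suc n)

  adm-cong : ∀ {y z} → (∀ k → k < n → y k ≡ z k) → Adm y → Adm z
  adm-cong h ad {i} i≤n {j} j≤n q = subst (rank w i j ≤_) (rank-cong i j λ c c<i → h c (<-≤-trans c<i (≤-pred i≤n))) (ad i≤n j≤n q)

  adm-cong′ : ∀ {y z} → (∀ k → y k ≡ z k) → Adm y → Adm z
  adm-cong′ h = adm-cong λ k _ → h k

  -- Exchanging an ascent only lowers ranks, so admissibility passes from the larger element to the
  -- smaller one: admissible elements form a down-set.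
  adm-dom : ∀ {p q z z′} → p < q → z p ≤ z q → (∀ k → z′ k ≡ sw p q z k) → Adm z′ → Adm z
  adm-dom {p} {q} {z} p<q zp≤zq h ad {i} i≤n {j} j≤n qij =
    ≤-trans (ad i≤n j≤n qij) (≤-trans (≤-reflexive (rank-cong i j λ c _ → h c)) (rank-sw-le z i j p<q zp≤zq))

  -- Up to position m the rank of R is that of F, and beyond it that of G.
  adm-both : ∀ {p m q F G R} → p < m → m < q → (∀ k → R k ≡ sw m q F k) → (∀ k → R k ≡ sw p m G k)
           → Adm F → Adm G → Adm R
  adm-both {p} {m} {q} {F} {G} p<m m<q hF hG af ag {i} i≤n {j} j≤n qij with i ≤? m
  ... | yes i≤m = ≤-trans (af i≤n j≤n qij) (≤-reflexive (sym (trans (rank-cong i j λ c _ → hF c) (rank-sw-≤ m q F i j i≤m (≤-trans i≤m (<⇒≤ m<q))))))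
  ... | no i≰m  = ≤-trans (ag i≤n j≤n qij) (≤-reflexive (sym (trans (rank-cong i j λ c _ → hG c) (rank-sw-> p m G i j (<-trans p<m (≰⇒> i≰m)) (≰⇒> i≰m) (<⇒≢ p<m)))))

  -- Ordered pairs are counted, the diagonal included. For admissible `y` the value is therefore n
  -- plus twice the number of reflections t with y t admissible, and the sum can be treated row by
  -- row.
  M : (ℕ → ℕ) → ℕ
  M y = sumTo n λ c → sumTo n λ d → 𝟙 (adm? (sw c d y))

  M-cong : ∀ {y z} → (∀ k → k < n → y k ≡ z k) → M y ≤ M z
  M-cong {y} {z} h = sumTo-mono n λ c c<n → sumTo-mono n λ d d<n → 𝟙-mono (adm? _) (adm? _) (adm-cong (sw-cong-< c d c<n d<n))
    where
      sw-cong-< : ∀ c d → c < n → d < n → ∀ k → k < n → sw c d y k ≡ sw c d z k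
      sw-cong-< c d c<n d<n k k<n = case k ≟ c of λ
        { (yes refl) → trans (sw-l c d y) (trans (h d d<n) (sym (sw-l c d z)))
        ; (no k≢c) → case k ≟ d of λ
          { (yes refl) → trans (sw-r c d y) (trans (h c c<n) (sym (sw-r c d z)))
          ; (no k≢d) → trans (sw-o c d y k≢c k≢d) (trans (h k k<n) (sym (sw-o c d z k≢c k≢d))) } }

  -- Gasharov's injection for one position c: among the values A < B, C at a < b, c, compare
  -- P₁ = (C,A,B), P₂ = (B,C,A), the two reflections of y(a b), with R₁ = (C,B,A), R₂ = (A,C,B), those of y.
  pair : ∀ {a b} y c → a < b → y a ≤ y b → Adm y → c ≢ a → c ≢ b
       → 𝟙 (adm? (sw c a (sw a b y))) + 𝟙 (adm? (sw c b (sw a b y))) ≤ 𝟙 (adm? (sw c a y)) + 𝟙 (adm? (sw c b y))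
  pair {a} {b} y c a<b A≤B ady c≢a c≢b = case c <? a of λ
    -- For `c` outside the interval from `a` to `b`, one of R₁, R₂ follows from either of P₁, P₂ and
    -- the other from both together. For `c` inside it, P₁ gives R₁ and P₂ gives R₂.
    { (yes c<a) → 𝟙-pair-lat (adm? _) (adm? _) (adm? _) (adm? _)
        (λ { (inj₁ ad) → P₁⇒R₁ (<-trans c<a a<b) ad
           ; (inj₂ ad) → case y c ≤? y b of λ
               { (yes C≤B) → P₂⇒R₁ C≤B ad
               -- Here C exceeds both A and B, so R₁ lies below `y` itself and P₂ is not consulted.
               ; (no C≰B)  → adm-dom c<a (le-via (proj₁ (proj₂ (proj₂ R₁))) (proj₁ R₁) (≤-trans A≤B (<⇒≤ (≰⇒> C≰B))))
                               (tri-unique tri-base (tri-ca a≢b c≢b R₁)) ady } })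
        (λ ad₁ ad₂ → adm-both c<a a<b (tri-unique R₂ (tri-ab c≢a c≢b P₁)) (tri-unique R₂ (tri-ca a≢b c≢b P₂)) ad₁ ad₂)
    ; (no c≮a) → case c <? b of λ
      { (yes c<b) → 𝟙-pair-par (adm? _) (adm? _) (adm? _) (adm? _) (P₁⇒R₁ c<b) (P₂⇒R₂ (≤∧≢⇒< (≮⇒≥ c≮a) (c≢a ∘ sym)))
      ; (no c≮b) → let b<c = ≤∧≢⇒< (≮⇒≥ c≮b) (c≢b ∘ sym) in
          ≤-trans (𝟙-pair-lat (adm? _) (adm? _) (adm? (sw c b y)) (adm? (sw c a y))
            (λ { (inj₁ ad) → case y a ≤? y c of λ
                   { (yes A≤C) → adm-dom a<b (le-via (proj₁ R₂) (proj₁ (proj₂ R₂)) A≤C) (tri-unique P₁ (tri-ab c≢a c≢b R₂)) ad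
                   ; (no A≰C)  → adm-dom b<c (le-via (proj₁ (proj₂ R₂)) (proj₁ (proj₂ (proj₂ R₂))) (≤-trans (<⇒≤ (≰⇒> A≰C)) A≤B))
                                   (tri-unique tri-base (tri-comm (tri-cb a≢b c≢a R₂))) ady }
               ; (inj₂ ad) → P₂⇒R₂ (<-trans a<b b<c) ad })
            (λ ad₁ ad₂ → adm-both a<b b<c (tri-unique R₁ (tri-comm (tri-cb a≢b c≢a P₁))) (tri-unique R₁ (tri-ab c≢a c≢b P₂)) ad₁ ad₂))
          (≤-reflexive (+-comm (𝟙 (adm? (sw c b y))) _)) } }
    where
      a≢b : a ≢ b
      a≢b = <⇒≢ a<b
      P₁ : Tri y a b c (sw c a (sw a b y)) (y c) (y a) (y b)
      P₁ = tri-ca a≢b c≢b (tri-ab c≢a c≢b tri-base)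
      P₂ : Tri y a b c (sw c b (sw a b y)) (y b) (y c) (y a)
      P₂ = tri-cb a≢b c≢a (tri-ab c≢a c≢b tri-base)
      R₁ : Tri y a b c (sw c a y) (y c) (y b) (y a)
      R₁ = tri-ca a≢b c≢b tri-base
      R₂ : Tri y a b c (sw c b y) (y a) (y c) (y b)
      R₂ = tri-cb a≢b c≢a tri-base
      le-via : ∀ {u v p q : ℕ} → u ≡ p → v ≡ q → p ≤ q → u ≤ v
      le-via refl refl h = h
      P₁⇒R₁ : c < b → Adm (sw c a (sw a b y)) → Adm (sw c a y)
      P₁⇒R₁ c<b = adm-dom c<b (le-via (proj₁ (proj₂ (proj₂ R₁))) (proj₁ (proj₂ R₁)) A≤B) (tri-unique P₁ (tri-cb a≢b c≢a R₁))
      P₂⇒R₁ : y c ≤ y b → Adm (sw c b (sw a b y)) → Adm (sw c a y)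
      P₂⇒R₁ C≤B = adm-dom a<b (le-via (proj₁ R₁) (proj₁ (proj₂ R₁)) C≤B) (tri-unique P₂ (tri-ab c≢a c≢b R₁))
      P₂⇒R₂ : a < c → Adm (sw c b (sw a b y)) → Adm (sw c b y)
      P₂⇒R₂ a<c = adm-dom a<c (le-via (proj₁ R₂) (proj₁ (proj₂ (proj₂ R₂))) A≤B) (tri-unique P₂ (tri-comm (tri-ca a≢b c≢b R₂)))

  -- The table of pairs is cut along `a` and `b`. A reflection disjoint from both commutes with the
  -- exchange and is handled by `adm-dom`; one that shares a single position falls under `pair`; the
  -- cells with both indices among `a`, `b` hold `y` or `sw a b y` and are admissible on either
  -- side.
  M-antitone : ∀ {a b} y → a < b → b < n → y a ≤ y b → Adm (sw a b y) → M (sw a b y) ≤ M y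
  M-antitone {a} {b} y a<b b<n A≤B ady′ = sumTo-mono₂ 0 n a b a≢b a<n b<n row rows
    where
      a≢b : a ≢ b
      a≢b = <⇒≢ a<b
      a<n : a < n
      a<n = <-trans a<b b<n
      ady : Adm y
      ady = adm-dom a<b A≤B (λ _ → refl) ady′
      row : ∀ c → c < n → c ≢ a → c ≢ b
          → sumTo n (λ d → 𝟙 (adm? (sw c d (sw a b y)))) ≤ sumTo n (λ d → 𝟙 (adm? (sw c d y)))
      row c c<n c≢a c≢b = sumTo-mono₂ 0 n a b a≢b a<n b<n
        (λ d d<n d≢a d≢b → 𝟙-mono (adm? _) (adm? _)
          (adm-dom a<b (subst₂ _≤_ (sym (sw-o c d y (c≢a ∘ sym) (d≢a ∘ sym))) (sym (sw-o c d y (c≢b ∘ sym) (d≢b ∘ sym))) A≤B)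
            (sw-disjoint y c≢a c≢b d≢a d≢b)))
        (pair y c a<b A≤B ady c≢a c≢b)
      flip≤ : ∀ d e z → 𝟙 (adm? (sw d e z)) ≤ 𝟙 (adm? (sw e d z))
      flip≤ d e z = 𝟙-mono (adm? _) (adm? _) (adm-cong′ (sw-comm d e z))
      two : ∀ {P Q R S : Set} (p : Dec P) (q : Dec Q) (r : Dec R) (s : Dec S) → R → S → 𝟙 p + 𝟙 q ≤ 𝟙 r + 𝟙 s
      two p q r s hr hs = 𝟙-pair-par p q r s (λ _ → hr) (λ _ → hs)
      cell : ∀ d → d < n → 𝟙 (adm? (sw a d (sw a b y))) + 𝟙 (adm? (sw b d (sw a b y))) ≤ 𝟙 (adm? (sw a d y)) + 𝟙 (adm? (sw b d y))
      cell d d<n = case d ≟ a of λ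
        { (yes refl) → two (adm? _) (adm? _) (adm? _) (adm? _) (adm-cong′ (λ k → sym (sw-id d y k)) ady) (adm-cong′ (sw-comm d b y) ady′)
        ; (no d≢a) → case d ≟ b of λ
          { (yes refl) → two (adm? _) (adm? _) (adm? _) (adm? _) ady′ (adm-cong′ (λ k → sym (sw-id d y k)) ady)
          ; (no d≢b) → ≤-trans (+-mono-≤ (flip≤ a d _) (flip≤ b d _)) (≤-trans (pair y d a<b A≤B ady d≢a d≢b) (+-mono-≤ (flip≤ d a y) (flip≤ d b y))) } }
      rows : sumTo n (λ d → 𝟙 (adm? (sw a d (sw a b y)))) + sumTo n (λ d → 𝟙 (adm? (sw b d (sw a b y))))
           ≤ sumTo n (λ d → 𝟙 (adm? (sw a d y))) + sumTo n (λ d → 𝟙 (adm? (sw b d y)))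
      rows = subst₂ _≤_ (sumTo-+ n _ _) (sumTo-+ n _ _) (sumTo-mono n cell)

-- The rank criterion for the Bruhat order

RankLe : ℕ → (ℕ → ℕ) → (ℕ → ℕ) → Set
RankLe n w y = ∀ i j → i ≤ n → j ≤ n → rank w i j ≤ rank y i j

Bounded : ℕ → (ℕ → ℕ) → Set
Bounded n y = ∀ c → c < n → y c < n

-- Together with `Bounded` this says that both functions have the same multiset of values on the
-- first n positions. It stands in for bijectivity and is visibly preserved by exchanges.
SameValues : ℕ → (ℕ → ℕ) → (ℕ → ℕ) → Set
SameValues n y w = ∀ j → j ≤ n → rank y n j ≡ rank w n j

bounded-sw : ∀ {n a b y} → a < n → b < n → Bounded n y → Bounded n (sw a b y)
bounded-sw {n} {a} {b} {y} a<n b<n bnd c c<n = case c ≟ a of λ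
  { (yes refl) → subst (_< n) (sym (sw-l a b y)) (bnd b b<n)
  ; (no c≢a) → case c ≟ b of λ
    { (yes refl) → subst (_< n) (sym (sw-r a b y)) (bnd a a<n)
    ; (no c≢b) → subst (_< n) (sym (sw-o a b y c≢a c≢b)) (bnd c c<n) } }

sameValues-sw : ∀ {n a b y w} → a < b → b < n → SameValues n y w → SameValues n (sw a b y) w
sameValues-sw {n} {a} {b} {y} a<b b<n sv j j≤n = trans (rank-sw-> a b y n j (<-trans a<b b<n) b<n (<⇒≢ a<b)) (sv j j≤n)

-- The termination measure of every recursion along ascents: an exchange lowers the rank at the box
-- (b , y b) by one and raises no rank.
total : ℕ → (ℕ → ℕ) → ℕ
total n y = sumTo (suc n) λ i → sumTo (suc n) λ j → rank y i j

total-sw : ∀ {n a b y} → a < b → b < n → y a < y b → y b < n → total n (sw a b y) < total n y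
total-sw {n} {a} {b} {y} a<b b<n ya<yb yb<n = sumTo-strict (suc n)
  (λ i _ → sumTo-mono (suc n) λ j _ → rank-sw-le y i j a<b (<⇒≤ ya<yb)) b (m<n⇒m<1+n b<n)
  (sumTo-strict (suc n) (λ j _ → rank-sw-le y b j a<b (<⇒≤ ya<yb)) (y b) (m<n⇒m<1+n yb<n)
    (≤-reflexive (rank-sw-drop y b (y b) a<b ≤-refl ya<yb ≤-refl)))

module FirstDifference {n : ℕ} {w y : ℕ → ℕ} (le : RankLe n w y) (w<n : Bounded n w)
                       {a : ℕ} (a<n : a < n) (ya≢wa : y a ≢ w a) (before : ∀ k → k < a → y k ≡ w k) where

  private
    eqa : ∀ j → rank y a j ≡ rank w a j
    eqa j = rank-cong a j before

  ya<wa : y a < w a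
  ya<wa = ≤∧≢⇒< (≤-pred (𝟙-pos (y a <? suc (w a)) (subst (_≤ lt (y a) (suc (w a))) (lt-yes {w a} ≤-refl)
      (+-cancelˡ-≤ (rank w a (suc (w a))) _ _ (subst (λ r → rank w a (suc (w a)) + lt (w a) (suc (w a)) ≤ r + lt (y a) (suc (w a))) (eqa (suc (w a)))
        (le (suc a) (suc (w a)) a<n (w<n a a<n))))))) ya≢wa

  module _ {j : ℕ} (ya<j : y a < j) (j≤wa : j ≤ w a) where

    y-side : ∀ d → (∀ c → a < c → c < suc a + d → ¬ (y a < y c × y c ≤ w a))
           → rank y (suc a + d) (suc (w a)) + rank w a j ≤ rank y (suc a + d) j + rank w a (suc (w a))
    y-side zero none rewrite +-identityʳ a | eqa j | eqa (suc (w a)) | lt-yes ya<j | lt-yes {y a} {suc (w a)} (m<n⇒m<1+n ya<wa) =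
      ≤-reflexive (trans (+-assoc (rank w a (suc (w a))) 1 _) (trans (cong (rank w a (suc (w a)) +_) (+-comm 1 _)) (+-comm (rank w a (suc (w a))) _)))
    y-side (suc d) none rewrite +-suc a d = begin
      (rank y (suc a + d) (suc (w a)) + lt (y (suc a + d)) (suc (w a))) + rank w a j ≡⟨ swap₃ (rank y (suc a + d) (suc (w a))) _ _ ⟩
      (rank y (suc a + d) (suc (w a)) + rank w a j) + lt (y (suc a + d)) (suc (w a)) ≤⟨ +-mono-≤ (y-side d λ c a<c c< → none c a<c (m<n⇒m<1+n c<))
           (lt-mono λ yc<1+wa → ≤-<-trans (≮⇒≥ λ ya<yc → none (suc a + d) (m≤m+n (suc a) d) ≤-refl (ya<yc , ≤-pred yc<1+wa)) ya<j) ⟩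
      (rank y (suc a + d) j + rank w a (suc (w a))) + lt (y (suc a + d)) j ≡⟨ swap₃ (rank y (suc a + d) j) _ _ ⟩
      (rank y (suc a + d) j + lt (y (suc a + d)) j) + rank w a (suc (w a)) ∎
      where
        open ≤-Reasoning

    w-side : ∀ d → suc (rank w (suc a + d) j + rank w a (suc (w a))) ≤ rank w (suc a + d) (suc (w a)) + rank w a j
    w-side zero rewrite +-identityʳ a | lt-no j≤wa | lt-yes {w a} {suc (w a)} ≤-refl =
      ≤-reflexive (trans (cong (λ e → suc (e + rank w a (suc (w a)))) (+-identityʳ (rank w a j))) (trans (cong suc (+-comm (rank w a j) _)) (cong (_+ rank w a j) (+-comm 1 _))))
    w-side (suc d) rewrite +-suc a d = begin
      suc ((rank w (suc a + d) j + lt (w (suc a + d)) j) + rank w a (suc (w a))) ≡⟨ cong suc (swap₃ (rank w (suc a + d) j) _ _) ⟩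
      suc (rank w (suc a + d) j + rank w a (suc (w a))) + lt (w (suc a + d)) j ≤⟨ +-mono-≤ (w-side d) (lt-mono λ wc<j → <-≤-trans wc<j (m≤n⇒m≤1+n j≤wa)) ⟩
      (rank w (suc a + d) (suc (w a)) + rank w a j) + lt (w (suc a + d)) (suc (w a)) ≡⟨ swap₃ (rank w (suc a + d) (suc (w a))) _ _ ⟩
      (rank w (suc a + d) (suc (w a)) + lt (w (suc a + d)) (suc (w a))) + rank w a j ∎
      where
        open ≤-Reasoning

    -- Look at the values from `j` to `w a` at the positions from `a` up to `i`. There `y` has no
    -- point (`y-side`), while `w` has at least the one at `a` (`w-side`). Hence the weak inequality
    -- at height `suc (w a)` becomes strict at height `j`.
    gap : ∀ i → a < i → i ≤ n → (∀ c → a < c → c < i → ¬ (y a < y c × y c ≤ w a)) → rank w i j < rank y i j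
    gap i a<i i≤n none with m≤n⇒∃[o]m+o≡n a<i
    ... | d , refl = +-cancelʳ-≤ (rank w a (suc (w a))) _ _ (begin
      suc (rank w (suc a + d) j + rank w a (suc (w a)))    ≤⟨ w-side d ⟩
      rank w (suc a + d) (suc (w a)) + rank w a j          ≤⟨ +-monoˡ-≤ (rank w a j) (le (suc a + d) (suc (w a)) i≤n (w<n a a<n)) ⟩
      rank y (suc a + d) (suc (w a)) + rank w a j          ≤⟨ y-side d none ⟩
      rank y (suc a + d) j + rank w a (suc (w a)) ∎)
      where open ≤-Reasoning

Ascent : ℕ → (ℕ → ℕ) → (ℕ → ℕ) → Set
Ascent n w y = Σ ℕ λ a → Σ ℕ λ b → a < b × b < n × y a < y b × RankLe n w (sw a b y)

sw-RankLe : ∀ {n a b w y} → a < b → y a < y b → RankLe n w y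
        → (∀ i j → i ≤ n → j ≤ n → a < i → i ≤ b → y a < j → j ≤ y b → rank w i j < rank y i j) → RankLe n w (sw a b y)
sw-RankLe {n} {a} {b} {w} {y} a<b ya<yb le h i j i≤n j≤n with a <? i | i ≤? b | y a <? j | j ≤? y b
... | yes p | yes q | yes r | yes s = ≤-pred (subst (suc (rank w i j) ≤_) (sym (rank-sw-drop y i j p q r s)) (h i j i≤n j≤n p q r s))
... | no ¬p | _ | _ | _ = ≤-trans (le i j i≤n j≤n) (≤-reflexive (sym (rank-sw-eq y i j a<b ya<yb λ { (p , _) → ¬p p })))
... | yes _ | no ¬q | _ | _ = ≤-trans (le i j i≤n j≤n) (≤-reflexive (sym (rank-sw-eq y i j a<b ya<yb λ { (_ , q , _) → ¬q q })))
... | yes _ | yes _ | no ¬r | _ = ≤-trans (le i j i≤n j≤n) (≤-reflexive (sym (rank-sw-eq y i j a<b ya<yb λ { (_ , _ , r , _) → ¬r r })))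
... | yes _ | yes _ | yes _ | no ¬s = ≤-trans (le i j i≤n j≤n) (≤-reflexive (sym (rank-sw-eq y i j a<b ya<yb λ { (_ , _ , _ , s) → ¬s s })))

-- Let `a` be the first difference and `b` the next position whose value lies above `y a` and at
-- most at `w a`. By `gap` there is room for the exchange in its whole rectangle. If there were no
-- such `b`, `gap` at the last column would contradict `SameValues`.
ascend : ∀ n w y → RankLe n w y → Bounded n w → SameValues n y w → (∀ k → k < n → y k ≡ w k) ⊎ Ascent n w y
ascend n w y le w<n sv with least (λ k → ¬? (y k ≟ w k)) n
... | inj₁ none = inj₁ λ k k<n → decidable-stable (y k ≟ w k) (none k k<n)
... | inj₂ (a , a<n , ya≢wa , before′) = inj₂ (climb (least (λ b → (a <? b) ×-dec ((y a <? y b) ×-dec (y b ≤? w a))) n))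
  where
    before : ∀ k → k < a → y k ≡ w k
    before k k<a = decidable-stable (y k ≟ w k) (before′ k k<a)
    open FirstDifference le w<n a<n ya≢wa before
    climb : _ → Ascent n w y
    climb (inj₁ none) = ⊥-elim (<-irrefl (sym (sv (w a) (<⇒≤ (w<n a a<n))))
      (gap {w a} ya<wa ≤-refl n a<n ≤-refl λ c a<c c<n (p , q) → none c c<n (a<c , p , q)))
    climb (inj₂ (b , b<n , (a<b , ya<yb , yb≤wa) , first)) = a , b , a<b , b<n , ya<yb ,
      sw-RankLe a<b ya<yb le λ i j i≤n j≤n a<i i≤b ya<j j≤yb → gap ya<j (≤-trans j≤yb yb≤wa) i a<i i≤n
        λ c a<c c<i (p , q) → first c (<-≤-trans c<i i≤b) (a<c , p , q)

-- Exchanges that stay below w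

module Total (n : ℕ) (w : ℕ → ℕ) = Admissible n w (λ _ _ → ⊤) (λ _ _ → yes tt)

-- Climb from `y` to `w` by `ascend`; every intermediate element is below `w`, so by `M-antitone`
-- the count never grows on the way.
M-top : ∀ n w → Bounded n w → ∀ fuel y → total n y < fuel → RankLe n w y → Bounded n y → SameValues n y w
      → Total.M n w w ≤ Total.M n w y
M-top n w w<n (suc fuel) y t<f le y<n sv with ascend n w y le w<n sv
... | inj₁ eq = Total.M-cong n w λ k k<n → sym (eq k k<n)
... | inj₂ (a , b , a<b , b<n , ya<yb , le′) = ≤-trans
  (M-top n w w<n fuel (sw a b y) (<-≤-trans (total-sw a<b b<n ya<yb (y<n b b<n)) (≤-pred t<f)) le′ (bounded-sw (<-trans a<b b<n) b<n y<n) (sameValues-sw a<b b<n sv))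
  (Total.M-antitone n w y a<b b<n (<⇒≤ ya<yb) λ {i} i≤n {j} j≤n _ → le′ i j (≤-pred i≤n) (≤-pred j≤n))

module Reachable (n : ℕ) (w : ℕ → ℕ) (w<n : Bounded n w) (V : ℕ → ℕ → Set) (V? : ∀ i j → Dec (V i j))
                 (V-last : ∀ j → j ≤ n → V n j) where

  open Admissible n w V V?

  -- The field `few` is an equality in disguise: by `M-top`, and because admissibility everywhere
  -- implies admissibility on `V`, the opposite inequality also holds.
  record Good (y : ℕ → ℕ) : Set where
    field
      bounded : Bounded n y
      le      : RankLe n w y
      onX     : ∀ i j → i ≤ n → j ≤ n → V i j → rank y i j ≡ rank w i j
      few     : M y ≤ Total.M n w w

  -- Equality of the two counts for y forces every reflection of y that is admissible on V to lie below w.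
  move : ∀ {y c d} → Good y → c < d → d < n → y c < y d
       → (∀ r s → c < r → r ≤ d → y c < s → s ≤ y d → ¬ V r s) → Good (sw c d y)
  move {y} {c} {d} g c<d d<n yc<yd avoid = record
    { bounded = bounded-sw c<n d<n bounded
    ; le      = λ i j i≤n j≤n → below (s≤s i≤n) (s≤s j≤n) tt
    ; onX     = onX′
    ; few     = ≤-trans (M-antitone y c<d d<n (<⇒≤ yc<yd) admX) few
    }
    where
      open Good g
      c<n : c < n
      c<n = <-trans c<d d<n
      onX′ : ∀ i j → i ≤ n → j ≤ n → V i j → rank (sw c d y) i j ≡ rank w i j
      onX′ i j i≤n j≤n x = trans (rank-sw-eq y i j c<d yc<yd λ (p , q , r , s) → avoid i j p q r s x) (onX i j i≤n j≤n x)
      admX : Adm (sw c d y)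
      admX i≤n j≤n x = ≤-reflexive (sym (onX′ _ _ (≤-pred i≤n) (≤-pred j≤n) x))
      entry : ∀ z → 𝟙 (Total.adm? n w z) ≤ 𝟙 (adm? z)
      entry z = 𝟙-mono (Total.adm? n w z) (adm? z) λ ad i≤n j≤n _ → ad i≤n j≤n tt
      below : Total.Adm n w (sw c d y)
      -- Otherwise the cell (c , d) would count in `M y` but not in `Total.M n w y`, and the chain
      -- from `M-top` to `few` would be strict.
      below = decidable-stable (Total.adm? n w (sw c d y)) λ ¬ad → <-irrefl refl (begin-strict
        Total.M n w w ≤⟨ M-top n w w<n (suc (total n y)) y ≤-refl le bounded (λ j j≤n → onX n j ≤-refl j≤n (V-last j j≤n)) ⟩
        Total.M n w y <⟨ sumTo-strict n (λ k _ → sumTo-mono n λ l _ → entry (sw k l y)) c c<n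
                          (sumTo-strict n (λ l _ → entry (sw c l y)) d d<n
                            (subst₂ _<_ (sym (𝟙-no (Total.adm? n w (sw c d y)) ¬ad)) (sym (𝟙-yes (adm? (sw c d y)) admX)) z<s)) ⟩
        M y           ≤⟨ few ⟩
        Total.M n w w ∎)
        where open ≤-Reasoning

-- Sweeping a quadrant

-- `Z` meets the closed rectangle between p and the near corner of the unit cell of a point at depth
-- `e ∸ 1` between `t` and `t + 1`; this is what it means that `Z` separates the point from p. For
-- `e` zero there is no such rectangle and no hit.
Hit : (ℕ → ℕ → Set) → ℕ → ℕ → Set
Hit Z e t = ∃ λ t′ → t′ < suc t × ∃ λ s → s < e × Z t′ s

hit? : {Z : ℕ → ℕ → Set} → (∀ t s → Dec (Z t s)) → ∀ e t → Dec (Hit Z e t)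
hit? Z? e t = anyUpTo? (λ t′ → anyUpTo? (Z? t′) e) (suc t)

-- The boxes of a quadrant at p are written (t , s), with p = (0 , 0).  The point of x between positions
-- t and t + 1 lies in the quadrant, at depth ex t ∸ 1, when ex t > 0; similarly for w.
module Sweep (T S : ℕ) (F : ℕ → ℕ → ℕ) (Z : ℕ → ℕ → Set) (Z? : ∀ t s → Dec (Z t s))
             (Z⇒0 : ∀ {t s} → t ≤ T → s ≤ S → Z t s → F t s ≡ 0) (0⇒Z : ∀ {t s} → t ≤ T → s ≤ S → F t s ≡ 0 → Z t s)
             (edge : ∀ t → t ≤ T → Z t S)
             (ex ew : ℕ → ℕ) (balance : ∀ t s → t < T → s ≤ S → F t s + lt s (ew t) ≡ F (suc t) s + lt s (ex t))
             (J : ℕ → ℕ → Set) (Z⇒J : ∀ {t s} → t ≤ T → s ≤ S → Z t s → J t s)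
             (rule : ∀ t s s′ → 0 < t → t ≤ T → s < s′ → s′ ≤ S → Z t s′ → J t s → J 0 s′
                   → (∀ t′ → t′ < t → s < ew t′ → s′ < ew t′) → J 0 s) where

  blocked : ℕ → ℕ
  blocked t = sumTo t λ t′ → 𝟙 (hit? Z? (ex t′) t′)

  inside : ℕ → ℕ
  inside t = sumTo t λ t′ → lt 0 (ew t′)

  -- `σ` is the least depth at which `Z` occurs in the first `t` columns, so whether a point of x is
  -- blocked is decided by comparing its depth with the current `σ` (`hit-lt`). The term `F t σ`
  -- makes the inequality inductive, and `tight` extracts influence from equality.
  record Front (t : ℕ) : Set where
    field
      σ       : ℕ
      σ≤S     : σ ≤ S
      clear   : ∀ t′ s → t′ < t → s < σ → ¬ Z t′ s
      source  : ∃ λ t′ → t′ < t × Z t′ σ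
      bound   : blocked t + F t σ ≤ inside t
      tight   : inside t ≤ blocked t + F t σ → J 0 σ × (∀ t′ → t′ < t → 0 < ew t′ → σ < ew t′)

  private
    hit-lt : ∀ {t σ} → (∀ t′ s → t′ < suc t → s < σ → ¬ Z t′ s) → (∃ λ t′ → t′ < suc t × Z t′ σ) → ∀ e → 𝟙 (hit? Z? e t) ≡ lt σ e
    hit-lt {t} {σ} clear (t′ , t′<1+t , z) e = 𝟙-cong (hit? Z? e t) (σ <? e)
      (λ { (u , u<1+t , s , s<e , zus) → ≤-<-trans (≮⇒≥ λ s<σ → clear u s u<1+t s<σ zus) s<e })
      (λ σ<e → t′ , t′<1+t , σ , σ<e , z)

    lt-split : ∀ {σ e} → lt 0 e ≤ lt σ e → 0 < e → σ < e
    lt-split {σ} {e} h 0<e = 𝟙-pos (σ <? e) (subst (_≤ lt σ e) (lt-yes 0<e) h)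

    firstZ : ∀ t → t ≤ T → ∃ λ σ → σ ≤ S × Z t σ × (∀ s → s < σ → ¬ Z t s)
    firstZ t t≤T with least (Z? t) (suc S)
    ... | inj₁ none = ⊥-elim (none S ≤-refl (edge t t≤T))
    ... | inj₂ (σ , σ<1+S , z , first) = σ , ≤-pred σ<1+S , z , first

    both-tight : ∀ {a b c d} → a ≤ b → c ≤ d → b + d ≤ a + c → b ≤ a × d ≤ c
    both-tight {a} {b} {c} {d} a≤b c≤d h =
      +-cancelʳ-≤ c b a (≤-trans (+-monoʳ-≤ b c≤d) h) , +-cancelˡ-≤ b d c (≤-trans h (+-monoˡ-≤ c a≤b))

  front : ∀ t → suc t ≤ T → Front (suc t)
  front zero 1≤T with firstZ 0 z≤n
  ... | σ , σ≤S , z , first = record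
    { σ = σ ; σ≤S = σ≤S ; clear = clear ; source = 0 , z<s , z
    ; bound = ≤-trans (≤-reflexive eq) (lt-mono (≤-<-trans z≤n))
    ; tight = λ h → Z⇒J z≤n σ≤S z , λ { zero _ → lt-split (≤-trans h (≤-reflexive eq)) ; (suc _) (s≤s ()) } }
    where
      clear : ∀ t′ s → t′ < 1 → s < σ → ¬ Z t′ s
      clear zero s _ s<σ = first s s<σ
      clear (suc _) _ (s≤s ()) _
      eq : 𝟙 (hit? Z? (ex 0) 0) + F 1 σ ≡ lt σ (ew 0)
      eq = begin
        𝟙 (hit? Z? (ex 0) 0) + F 1 σ ≡⟨ cong (_+ F 1 σ) (hit-lt clear (0 , z<s , z) (ex 0)) ⟩
        lt σ (ex 0) + F 1 σ          ≡⟨ +-comm (lt σ (ex 0)) _ ⟩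
        F 1 σ + lt σ (ex 0)          ≡⟨ sym (balance 0 σ 1≤T σ≤S) ⟩
        F 0 σ + lt σ (ew 0)          ≡⟨ cong (_+ lt σ (ew 0)) (Z⇒0 z≤n σ≤S z) ⟩
        lt σ (ew 0) ∎
        where open ≡-Reasoning
  front (suc t) 2+t≤T with front t (<⇒≤ 2+t≤T)
  ... | old with least (Z? (suc t)) (Front.σ old)
  -- `Z` comes no nearer in this column: `σ` stays, and `balance` carries `F` one column further.
  ...   | inj₁ none = record
    { σ = σ ; σ≤S = σ≤S ; clear = clear′ ; source = t′ , m<n⇒m<1+n t′<1+t , z
    ; bound = ≤-trans (≤-reflexive eq) (+-mono-≤ bound (lt-mono (≤-<-trans z≤n)))
    ; tight = λ h → case both-tight bound (lt-mono (≤-<-trans z≤n)) (≤-trans h (≤-reflexive eq)) of λ (h₁ , h₂) →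
        proj₁ (tight h₁) , λ u u<2+t → case u ≟ suc t of λ
          { (yes refl) → lt-split h₂ ; (no u≢) → proj₂ (tight h₁) u (≤∧≢⇒< (≤-pred u<2+t) u≢) } }
    where
      open Front old
      t′ = proj₁ source
      t′<1+t = proj₁ (proj₂ source)
      z = proj₂ (proj₂ source)
      clear′ : ∀ u s → u < suc (suc t) → s < σ → ¬ Z u s
      clear′ u s u<2+t s<σ = case u ≟ suc t of λ
        { (yes refl) → none s s<σ ; (no u≢) → clear u s (≤∧≢⇒< (≤-pred u<2+t) u≢) s<σ }
      eq : (blocked (suc t) + 𝟙 (hit? Z? (ex (suc t)) (suc t))) + F (suc (suc t)) σ ≡ (blocked (suc t) + F (suc t) σ) + lt σ (ew (suc t))
      eq = begin
        (blocked (suc t) + 𝟙 (hit? Z? (ex (suc t)) (suc t))) + F (suc (suc t)) σ ≡⟨ +-assoc (blocked (suc t)) _ _ ⟩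
        blocked (suc t) + (𝟙 (hit? Z? (ex (suc t)) (suc t)) + F (suc (suc t)) σ) ≡⟨ cong (λ e → blocked (suc t) + (e + F (suc (suc t)) σ)) (hit-lt clear′ (t′ , m<n⇒m<1+n t′<1+t , z) (ex (suc t))) ⟩
        blocked (suc t) + (lt σ (ex (suc t)) + F (suc (suc t)) σ) ≡⟨ cong (blocked (suc t) +_) (trans (+-comm (lt σ (ex (suc t))) _) (sym (balance (suc t) σ 2+t≤T σ≤S))) ⟩
        blocked (suc t) + (F (suc t) σ + lt σ (ew (suc t))) ≡⟨ sym (+-assoc (blocked (suc t)) _ _) ⟩
        (blocked (suc t) + F (suc t) σ) + lt σ (ew (suc t)) ∎
        where open ≡-Reasoning
  -- `Z` comes nearer: `F` vanishes at the new `σ′`, and the old term `F (suc t) σ` is given away.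
  ...   | inj₂ (σ′ , σ′<σ , z , first) = record
    { σ = σ′ ; σ≤S = σ′≤S ; clear = clear′ ; source = suc t , ≤-refl , z
    ; bound = ≤-trans (≤-reflexive eq) (+-mono-≤ (≤-trans (m≤m+n _ _) bound) (lt-mono (≤-<-trans z≤n)))
    ; tight = tight′ }
    where
      open Front old
      σ′≤S : σ′ ≤ S
      σ′≤S = ≤-trans (<⇒≤ σ′<σ) σ≤S
      1+t≤T : suc t ≤ T
      1+t≤T = <⇒≤ 2+t≤T
      clear′ : ∀ u s → u < suc (suc t) → s < σ′ → ¬ Z u s
      clear′ u s u<2+t s<σ′ = case u ≟ suc t of λ
        { (yes refl) → first s s<σ′ ; (no u≢) → clear u s (≤∧≢⇒< (≤-pred u<2+t) u≢) (<-trans s<σ′ σ′<σ) }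
      eq : (blocked (suc t) + 𝟙 (hit? Z? (ex (suc t)) (suc t))) + F (suc (suc t)) σ′ ≡ blocked (suc t) + lt σ′ (ew (suc t))
      eq = begin
        (blocked (suc t) + 𝟙 (hit? Z? (ex (suc t)) (suc t))) + F (suc (suc t)) σ′ ≡⟨ +-assoc (blocked (suc t)) _ _ ⟩
        blocked (suc t) + (𝟙 (hit? Z? (ex (suc t)) (suc t)) + F (suc (suc t)) σ′) ≡⟨ cong (λ e → blocked (suc t) + (e + F (suc (suc t)) σ′)) (hit-lt clear′ (suc t , ≤-refl , z) (ex (suc t))) ⟩
        blocked (suc t) + (lt σ′ (ex (suc t)) + F (suc (suc t)) σ′) ≡⟨ cong (blocked (suc t) +_) (trans (+-comm (lt σ′ (ex (suc t))) _) (sym (balance (suc t) σ′ 2+t≤T σ′≤S))) ⟩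
        blocked (suc t) + (F (suc t) σ′ + lt σ′ (ew (suc t))) ≡⟨ cong (λ e → blocked (suc t) + (e + lt σ′ (ew (suc t)))) (Z⇒0 1+t≤T σ′≤S z) ⟩
        blocked (suc t) + lt σ′ (ew (suc t)) ∎
        where open ≡-Reasoning
      tight′ : _ → _
      tight′ h with both-tight (≤-trans (m≤m+n (blocked (suc t)) (F (suc t) σ)) bound) (lt-mono (≤-<-trans z≤n)) (≤-trans h (≤-reflexive eq))
      ... | h₁ , h₂ with tight (≤-trans h₁ (m≤m+n _ _))
      -- Equality forces the term given away to be zero. So (suc t , σ) lies in `Z` and can be the
      -- partner through which influence descends from (0 , σ) to (0 , σ′).
      ...   | J0σ , deep = rule (suc t) σ′ σ z<s 1+t≤T σ′<σ σ≤S (0⇒Z 1+t≤T σ≤S Fσ≡0) (Z⇒J 1+t≤T σ′≤S z) J0σ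
                             (λ u u<1+t σ′<ew → deep u u<1+t (≤-<-trans z≤n σ′<ew))
                         , λ u u<2+t → case u ≟ suc t of λ
                             { (yes refl) → lt-split h₂ ; (no u≢) → λ 0<ew → <-trans σ′<σ (deep u (≤∧≢⇒< (≤-pred u<2+t) u≢) 0<ew) }
        where
          Fσ≡0 : F (suc t) σ ≡ 0
          Fσ≡0 = n≤0⇒n≡0 (+-cancelˡ-≤ (blocked (suc t)) _ _ (≤-trans bound (≤-trans h₁ (≤-reflexive (sym (+-identityʳ _))))))

  telescope : ∀ t → t ≤ T → F 0 0 + inside t ≡ F t 0 + sumTo t (λ t′ → lt 0 (ex t′))
  telescope zero    _   = refl
  telescope (suc t) t<T = begin
    F 0 0 + (inside t + lt 0 (ew t))     ≡⟨ sym (+-assoc (F 0 0) _ _) ⟩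
    (F 0 0 + inside t) + lt 0 (ew t)     ≡⟨ cong (_+ lt 0 (ew t)) (telescope t (<⇒≤ t<T)) ⟩
    (F t 0 + Σx) + lt 0 (ew t)           ≡⟨ swap₃ (F t 0) Σx _ ⟩
    (F t 0 + lt 0 (ew t)) + Σx           ≡⟨ cong (_+ Σx) (balance t 0 t<T z≤n) ⟩
    (F (suc t) 0 + lt 0 (ex t)) + Σx     ≡⟨ +-assoc (F (suc t) 0) _ _ ⟩
    F (suc t) 0 + (lt 0 (ex t) + Σx)     ≡⟨ cong (F (suc t) 0 +_) (+-comm _ Σx) ⟩
    F (suc t) 0 + (Σx + lt 0 (ex t)) ∎
    where
      open ≡-Reasoning
      Σx = sumTo t (λ t′ → lt 0 (ex t′))

  -- The hypothesis turns `bound` into an equality with `F t σ` zero, so (t , σ) lies in `Z` and one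
  -- more use of `rule` would carry influence from (t , 0) to p. The inequality for `F` comes from
  -- `telescope`, since blocked points of x are in particular points of the quadrant. The staircase
  -- data at `σ` are returned for later use in `Mid`.
  sweep : ∀ t → 0 < t → t ≤ T → inside t ≤ blocked t → ¬ J 0 0
        → ¬ J t 0 × F t 0 ≤ F 0 0 × ∃ λ σ → σ ≤ S × Z t σ × (∀ t′ s → t′ < t → s < σ → ¬ Z t′ s)
  sweep (suc t) _ t≤T h ¬J = (λ Jt0 → ¬J (derive Jt0)) , F≤ , σ , σ≤S , zσ , clear
    where
      open Front (front t t≤T)
      zσ : Z (suc t) σ
      zσ = 0⇒Z t≤T σ≤S (n≤0⇒n≡0 (+-cancelˡ-≤ (blocked (suc t)) _ _ (≤-trans bound (≤-trans h (≤-reflexive (sym (+-identityʳ _)))))))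
      J0σ,deep = tight (≤-trans h (m≤m+n _ _))
      derive : J (suc t) 0 → J 0 0
      derive Jt0 with 0 ≟ σ
      ... | yes 0≡σ = subst (J 0) (sym 0≡σ) (proj₁ J0σ,deep)
      ... | no 0≢σ  = rule (suc t) 0 σ z<s t≤T (≤∧≢⇒< z≤n 0≢σ) σ≤S zσ Jt0 (proj₁ J0σ,deep) (proj₂ J0σ,deep)
      F≤ : F (suc t) 0 ≤ F 0 0
      F≤ = +-cancelʳ-≤ (sumTo (suc t) (λ t′ → lt 0 (ex t′))) _ _ (begin
        F (suc t) 0 + sumTo (suc t) (λ t′ → lt 0 (ex t′)) ≡⟨ sym (telescope (suc t) t≤T) ⟩
        F 0 0 + inside (suc t)                           ≤⟨ +-monoʳ-≤ (F 0 0) (≤-trans h (sumTo-mono (suc t) λ t′ _ →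
             𝟙-mono (hit? Z? (ex t′) t′) (0 <? ex t′) λ { (_ , _ , s , s<e , _) → ≤-<-trans z≤n s<e })) ⟩
        F 0 0 + sumTo (suc t) (λ t′ → lt 0 (ex t′)) ∎)
        where open ≤-Reasoning

-- Exchanges avoiding V

∸-suc : ∀ {i t} → t < i → i ∸ t ≡ suc (i ∸ suc t)
∸-suc {suc i} {zero}  _         = refl
∸-suc {suc i} {suc t} (s≤s t<i) = ∸-suc t<i

rank-down : ∀ y i v t → t ≤ i → rank y i v ≡ rank y (i ∸ t) v + sumTo t (λ t′ → lt (y (i ∸ suc t′)) v)
rank-down y i v zero    _   = sym (+-identityʳ _)
rank-down y i v (suc t) t<i = begin
  rank y i v ≡⟨ rank-down y i v t (<⇒≤ t<i) ⟩
  rank y (i ∸ t) v + Y ≡⟨ cong (λ r → rank y r v + Y) (∸-suc t<i) ⟩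
  (rank y (i ∸ suc t) v + lt (y (i ∸ suc t)) v) + Y ≡⟨ +-assoc (rank y (i ∸ suc t) v) _ _ ⟩
  rank y (i ∸ suc t) v + (lt (y (i ∸ suc t)) v + Y) ≡⟨ cong (rank y (i ∸ suc t) v +_) (+-comm _ Y) ⟩
  rank y (i ∸ suc t) v + (Y + lt (y (i ∸ suc t)) v) ∎
  where
    open ≡-Reasoning
    Y = sumTo t (λ t′ → lt (y (i ∸ suc t′)) v)

rank-up : ∀ y i v t → rank y (i + t) v ≡ rank y i v + sumTo t (λ t′ → lt (y (i + t′)) v)
rank-up y i v zero    rewrite +-identityʳ i = sym (+-identityʳ _)
rank-up y i v (suc t) rewrite +-suc i t = trans (cong (_+ lt (y (i + t)) v) (rank-up y i v t)) (+-assoc (rank y i v) _ _)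

ge : ℕ → ℕ → ℕ
ge a b = 𝟙 (b ≤? a)

lt+ge : ∀ a b → lt a b + ge a b ≡ 1
lt+ge a b with a <? b | b ≤? a
... | yes a<b | yes b≤a = ⊥-elim (<⇒≱ a<b b≤a)
... | yes _   | no _    = refl
... | no _    | yes _   = refl
... | no a≮b  | no b≰a  = ⊥-elim (a≮b (≰⇒> b≰a))

ge-anti : ∀ t (f g : ℕ → ℕ) v → sumTo t (λ k → lt (f k) v) ≤ sumTo t (λ k → lt (g k) v) → sumTo t (λ k → ge (g k) v) ≤ sumTo t (λ k → ge (f k) v)
ge-anti t f g v h = +-cancelˡ-≤ (sumTo t (λ k → lt (f k) v)) _ _ (≤-trans (+-monoˡ-≤ _ h) (≤-reflexive (trans (all g) (sym (all f)))))
  where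
    all : ∀ h → sumTo t (λ k → lt (h k) v) + sumTo t (λ k → ge (h k) v) ≡ t * 1
    all h = trans (sym (sumTo-+ t _ _)) (trans (sumTo-cong t λ k _ → lt+ge (h k) v) (sumTo-const t 1))

0<n∸m⇒m<n : ∀ m {n} → 0 < n ∸ m → m < n
0<n∸m⇒m<n m h = ≰⇒> λ n≤m → <-irrefl (sym (m≤n⇒m∸n≡0 n≤m)) h

hit-mono : ∀ {Z : ℕ → ℕ → Set} {e e′ t} → e ≤ e′ → Hit Z e t → Hit Z e′ t
hit-mono e≤e′ (t′ , t′<1+t , s , s<e , z) = t′ , t′<1+t , s , <-≤-trans s<e e≤e′ , z

module Descent (n : ℕ) (w : ℕ → ℕ) (w<n : Bounded n w) (V : ℕ → ℕ → Set) (V? : ∀ i j → Dec (V i j))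
               (V-last : ∀ j → j ≤ n → V n j)
               (i j e : ℕ) (i<n : i < n) (j≤n : j ≤ n) (0<e : 0 < e) (e≤i : e ≤ i)
               (mid : ∀ r v → e ≤ r → r < i → j ≤ v → (∀ v′ → j ≤ v′ → v′ ≤ v → ¬ V i v′) → ¬ V r v) where

  open Reachable n w w<n V V? V-last

  -- V in the coordinates of Sweep, from p = (i , j) towards the lower left (Z₋) and the upper right (Z₊).
  Z₋ Z₊ : ℕ → ℕ → Set
  Z₋ t s = V (i ∸ t) (j ∸ s)
  Z₊ t s = V (i + t) (j + s)

  Z₋? : ∀ t s → Dec (Z₋ t s)
  Z₋? t s = V? (i ∸ t) (j ∸ s)

  Z₊? : ∀ t s → Dec (Z₊ t s)
  Z₊? t s = V? (i + t) (j + s)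

  -- A point of value v occupies the cell between heights v and v + 1, which accounts for the `suc`
  -- on the upper side only. Truncated subtraction yields 0 exactly for points outside the quadrant.
  e₋ e₊ : (ℕ → ℕ) → ℕ → ℕ
  e₋ y t = j ∸ y (i ∸ suc t)
  e₊ y t = suc (y (i + t)) ∸ j

  blocked₋ blocked₊ inside₋ inside₊ : (ℕ → ℕ) → ℕ → ℕ
  blocked₋ y t = sumTo t λ t′ → 𝟙 (hit? Z₋? (e₋ y t′) t′)
  blocked₊ y t = sumTo t λ t′ → 𝟙 (hit? Z₊? (e₊ y t′) t′)
  inside₋ y t = sumTo t λ t′ → lt 0 (e₋ y t′)
  inside₊ y t = sumTo t λ t′ → lt 0 (e₊ y t′)

  -- Because of mid, the inequality on the left is only needed for positions below e.
  Inv₋ Inv₊ : (ℕ → ℕ) → Set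
  Inv₋ y = ∀ t → t ≤ i → i ∸ t < e → blocked₋ y t < inside₋ w t
  Inv₊ y = ∀ t → 0 < t → i + t ≤ n → blocked₊ y t < inside₊ w t

  -- The exchange raises the point left of p and lowers the one right of p. Depths shrink in both
  -- quadrants, so no further point becomes blocked, while the counts for `w` stay fixed.
  module Exchange {y : ℕ → ℕ} {c d : ℕ} (c<i : c < i) (i≤d : i ≤ d) (yc<yd : y c < y d) where

    e₋-le : ∀ t → t < i → e₋ (sw c d y) t ≤ e₋ y t
    e₋-le t t<i = case i ∸ suc t ≟ c of λ
      { (yes refl) → subst (λ v → j ∸ v ≤ j ∸ y c) (sym (sw-l c d y)) (∸-monoʳ-≤ j (<⇒≤ yc<yd))
      ; (no k≢c) → ≤-reflexive (cong (j ∸_) (sw-o c d y k≢c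
          λ k≡d → <⇒≱ (≤-trans (≤-reflexive (sym (∸-suc t<i))) (m∸n≤m i t)) (≤-trans i≤d (≤-reflexive (sym k≡d))))) }

    e₊-le : ∀ t → e₊ (sw c d y) t ≤ e₊ y t
    e₊-le t = case i + t ≟ d of λ
      { (yes refl) → subst (λ v → suc v ∸ j ≤ suc (y d) ∸ j) (sym (sw-r c d y)) (∸-monoˡ-≤ j (s≤s (<⇒≤ yc<yd)))
      ; (no k≢d) → ≤-reflexive (cong (λ v → suc v ∸ j) (sw-o c d y (λ k≡c → <⇒≱ c<i (≤-trans (m≤m+n i t) (≤-reflexive k≡c))) k≢d)) }

    inv₋ : Inv₋ y → Inv₋ (sw c d y)
    inv₋ h t t≤i u<e = ≤-<-trans (sumTo-mono t λ t′ t′<t → 𝟙-mono (hit? Z₋? _ t′) (hit? Z₋? _ t′) (hit-mono (e₋-le t′ (<-≤-trans t′<t t≤i)))) (h t t≤i u<e)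

    inv₊ : Inv₊ y → Inv₊ (sw c d y)
    inv₊ h t 0<t i+t≤n = ≤-<-trans (sumTo-mono t λ t′ _ → 𝟙-mono (hit? Z₊? _ t′) (hit? Z₊? _ t′) (hit-mono (e₊-le t′))) (h t 0<t i+t≤n)

  module _ {y : ℕ → ℕ} (g : Good y) where
    open Good g

    count₋ : ∀ t v → t ≤ i → v ≤ n → rank y (i ∸ t) v ≡ rank w (i ∸ t) v
           → sumTo t (λ t′ → lt (w (i ∸ suc t′)) v) ≤ sumTo t (λ t′ → lt (y (i ∸ suc t′)) v)
    count₋ t v t≤i v≤n eq = +-cancelˡ-≤ (rank w (i ∸ t) v) _ _ (begin
      rank w (i ∸ t) v + sumTo t (λ t′ → lt (w (i ∸ suc t′)) v) ≡⟨ sym (rank-down w i v t t≤i) ⟩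
      rank w i v ≤⟨ le i v (<⇒≤ i<n) v≤n ⟩
      rank y i v ≡⟨ rank-down y i v t t≤i ⟩
      rank y (i ∸ t) v + sumTo t (λ t′ → lt (y (i ∸ suc t′)) v) ≡⟨ cong (_+ _) eq ⟩
      rank w (i ∸ t) v + sumTo t (λ t′ → lt (y (i ∸ suc t′)) v) ∎)
      where open ≤-Reasoning

    count₊ : ∀ t v → i + t ≤ n → v ≤ n → V (i + t) v
           → sumTo t (λ t′ → ge (w (i + t′)) v) ≤ sumTo t (λ t′ → ge (y (i + t′)) v)
    count₊ t v i+t≤n v≤n x = ge-anti t (λ t′ → y (i + t′)) (λ t′ → w (i + t′)) v (+-cancelˡ-≤ (rank w i v) _ _ (begin
      rank w i v + sumTo t (λ t′ → lt (y (i + t′)) v) ≤⟨ +-monoˡ-≤ _ (le i v (<⇒≤ i<n) v≤n) ⟩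
      rank y i v + sumTo t (λ t′ → lt (y (i + t′)) v) ≡⟨ sym (rank-up y i v t) ⟩
      rank y (i + t) v ≡⟨ onX (i + t) v i+t≤n v≤n x ⟩
      rank w (i + t) v ≡⟨ rank-up w i v t ⟩
      rank w i v + sumTo t (λ t′ → lt (w (i + t′)) v) ∎))
      where open ≤-Reasoning

    -- Equal ranks at (i ∸ t , v) and larger rank of `y` at (i , v) give `y` at least as many points
    -- below `v` in between as `w` has. If all of these are blocked, `w` cannot win.
    starved₋ : ∀ t v → t ≤ i → i ∸ t < e → j ≤ v → v ≤ n → rank y (i ∸ t) v ≡ rank w (i ∸ t) v
             → (∀ t′ → t′ < t → y (i ∸ suc t′) < v → Hit Z₋ (e₋ y t′) t′) → ¬ Inv₋ y
    starved₋ t v t≤i u<e j≤v v≤n eq hits inv = <⇒≱ (inv t t≤i u<e) (begin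
      inside₋ w t                               ≤⟨ sumTo-mono t (λ t′ _ → lt-mono λ 0<e → <-≤-trans (0<n∸m⇒m<n (w (i ∸ suc t′)) 0<e) j≤v) ⟩
      sumTo t (λ t′ → lt (w (i ∸ suc t′)) v)    ≤⟨ count₋ t v t≤i v≤n eq ⟩
      sumTo t (λ t′ → lt (y (i ∸ suc t′)) v)    ≤⟨ sumTo-mono t (λ t′ t′<t → 𝟙-mono (y (i ∸ suc t′) <? v) (hit? Z₋? _ t′) (hits t′ t′<t)) ⟩
      blocked₋ y t ∎)
      where
        open ≤-Reasoning

    starved₊ : ∀ t v → 0 < t → i + t ≤ n → v ≤ j → V (i + t) v
             → (∀ t′ → t′ < t → v ≤ y (i + t′) → Hit Z₊ (e₊ y t′) t′) → ¬ Inv₊ y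
    starved₊ t v 0<t i+t≤n v≤j x hits inv = <⇒≱ (inv t 0<t i+t≤n) (begin
      inside₊ w t                             ≤⟨ sumTo-mono t (λ t′ _ → 𝟙-mono (0 <? e₊ w t′) (v ≤? w (i + t′)) λ 0<e → ≤-trans v≤j (≤-pred (0<n∸m⇒m<n j 0<e))) ⟩
      sumTo t (λ t′ → ge (w (i + t′)) v)      ≤⟨ count₊ t v i+t≤n (≤-trans v≤j j≤n) x ⟩
      sumTo t (λ t′ → ge (y (i + t′)) v)      ≤⟨ sumTo-mono t (λ t′ t′<t → 𝟙-mono (v ≤? y (i + t′)) (hit? Z₊? _ t′) (hits t′ t′<t)) ⟩
      blocked₊ y t ∎)
      where
        open ≤-Reasoning

  Swap : (ℕ → ℕ) → Set
  Swap y = Σ ℕ λ c → Σ ℕ λ d → c < i × i ≤ d × d < n × y c < y d × (∀ r s → c < r → r ≤ d → y c < s → s ≤ y d → ¬ V r s)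

  module FindSwap {y : ℕ → ℕ} (g : Good y) (h₋ : Inv₋ y) (h₊ : Inv₊ y) where
    open Good g

    Free₋ Free₊ : ℕ → Set
    Free₋ t = y (i ∸ suc t) < j × ¬ Hit Z₋ (e₋ y t) t
    Free₊ t = j ≤ y (i + t) × ¬ Hit Z₊ (e₊ y t) t

    free₋? : ∀ t → Dec (Free₋ t)
    free₋? t = (y (i ∸ suc t) <? j) ×-dec ¬? (hit? Z₋? (e₋ y t) t)

    free₊? : ∀ t → Dec (Free₊ t)
    free₊? t = (j ≤? y (i + t)) ×-dec ¬? (hit? Z₊? (e₊ y t) t)

    hit₋ : ∀ {t} → ¬ Free₋ t → y (i ∸ suc t) < j → Hit Z₋ (e₋ y t) t
    hit₋ {t} ¬f y<j = decidable-stable (hit? Z₋? (e₋ y t) t) λ ¬h → ¬f (y<j , ¬h)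

    hit₊ : ∀ {t} → ¬ Free₊ t → j ≤ y (i + t) → Hit Z₊ (e₊ y t) t
    hit₊ {t} ¬f j≤y = decidable-stable (hit? Z₊? (e₊ y t) t) λ ¬h → ¬f (j≤y , ¬h)

    first₋ : ∃ λ t → t < i × Free₋ t × (∀ k → k < t → ¬ Free₋ k)
    first₋ with least free₋? i
    ... | inj₂ found = found
    -- Sweep the whole quadrant: at position 0 both ranks vanish, so `starved₋` applies at height
    -- `j`.
    ... | inj₁ none  = ⊥-elim (starved₋ g i j ≤-refl (subst (_< e) (sym (n∸n≡0 i)) 0<e) ≤-refl j≤n
      (subst (λ u → rank y u j ≡ rank w u j) (sym (n∸n≡0 i)) refl) (λ t t<i → hit₋ (none t t<i)) h₋)

    first₊ : ∃ λ t → t < n ∸ i × Free₊ t × (∀ k → k < t → ¬ Free₊ k)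
    first₊ with least free₊? (n ∸ i)
    ... | inj₂ found = found
    -- On this side the sweep ends at position n, where every box belongs to `V`.
    ... | inj₁ none  = ⊥-elim (starved₊ g (n ∸ i) j (m<n⇒0<n∸m i<n) (≤-reflexive i+) ≤-refl (subst (λ u → V u j) (sym i+) (V-last j j≤n))
      (λ t t<T → hit₊ (none t t<T)) h₊)
      where
        i+ : i + (n ∸ i) ≡ n
        i+ = m+[n∸m]≡n (<⇒≤ i<n)

    -- a and b are the positions nearest to p of points of y that V does not separate from p.
    ta tb a b : ℕ
    ta = proj₁ first₋
    tb = proj₁ first₊
    a = i ∸ suc ta
    b = i + tb

    ta<i : ta < i
    ta<i = proj₁ (proj₂ first₋)
    ya<j : y a < j
    ya<j = proj₁ (proj₁ (proj₂ (proj₂ first₋)))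
    j≤yb : j ≤ y b
    j≤yb = proj₁ (proj₁ (proj₂ (proj₂ first₊)))
    b<n : b < n
    b<n = ≤-trans (≤-reflexive (sym (+-suc i tb))) (≤-trans (+-monoʳ-≤ i (proj₁ (proj₂ first₊))) (≤-reflexive (m+[n∸m]≡n (<⇒≤ i<n))))
    a<i : a < i
    a<i = ≤-trans (≤-reflexive (sym (∸-suc ta<i))) (m∸n≤m i ta)
    i≤b : i ≤ b
    i≤b = m≤m+n i tb

    row₋ : ∀ {c t} → t < i → i ∸ suc t < c → c ≤ i → i ∸ c ≤ t
    row₋ {c} {t} t<i h c≤i = ≤-trans (∸-monoʳ-≤ i (≤-trans (≤-reflexive (∸-suc t<i)) h)) (≤-reflexive (m∸[m∸n]≡n (<⇒≤ t<i)))

    free₋ : ∀ r s → a < r → r ≤ i → y a < s → s ≤ j → ¬ V r s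
    free₋ r s a<r r≤i ya<s s≤j x = proj₂ (proj₁ (proj₂ (proj₂ first₋)))
      (i ∸ r , s≤s (row₋ ta<i a<r r≤i) , j ∸ s , ∸-monoʳ-< ya<s s≤j , subst₂ V (sym (m∸[m∸n]≡n r≤i)) (sym (m∸[m∸n]≡n s≤j)) x)

    free₊ : ∀ r s → i ≤ r → r ≤ b → j ≤ s → s ≤ y b → ¬ V r s
    free₊ r s i≤r r≤b j≤s s≤yb x = proj₂ (proj₁ (proj₂ (proj₂ first₊)))
      (r ∸ i , s≤s (≤-trans (∸-monoˡ-≤ i r≤b) (≤-reflexive (m+n∸m≡n i tb))) , s ∸ j , ∸-monoˡ-< (s≤s s≤yb) j≤s
      , subst₂ V (sym (m+[n∸m]≡n i≤r)) (sym (m+[n∸m]≡n j≤s)) x)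

    NW SE : ℕ → Set
    NW t = 0 < t × ∃ λ v → v < suc (y b) × j < v × V (i ∸ t) v
    SE t = 0 < t × ∃ λ v → v < j × y a < v × V (i + t) v

    nw? : ∀ t → Dec (NW t)
    nw? t = (0 <? t) ×-dec anyUpTo? (λ v → (j <? v) ×-dec V? (i ∸ t) v) (suc (y b))

    se? : ∀ t → Dec (SE t)
    se? t = (0 <? t) ×-dec anyUpTo? (λ v → (y a <? v) ×-dec V? (i + t) v) j

    -- If the exchange of a and b is obstructed in the upper left block, a point of y between p and the
    -- nearest obstruction can be exchanged with b instead: without one, Inv₋ would fail there.
    slide-down : ∀ {t v} → t ≤ ta → 0 < t → v ≤ y b → j < v → V (i ∸ t) v → (∀ k → k < t → ¬ NW k) → Swap y
    slide-down {t} {v} t≤ta 0<t v≤yb j<v x first with e ≤? i ∸ t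
    -- From `e` on `Inv₋` says nothing, but `free₊` clears column `i` from `j` up to `y b`, so `mid`
    -- excludes the obstruction.
    ... | yes e≤u = ⊥-elim (mid (i ∸ t) v e≤u (∸-monoʳ-< 0<t (≤-trans t≤ta (<⇒≤ ta<i))) (<⇒≤ j<v)
                      (λ v′ j≤v′ v′≤v → free₊ i v′ ≤-refl i≤b j≤v′ (≤-trans v′≤v v≤yb)) x)
    ... | no e≰u with anyUpTo? (λ t′ → (j ≤? y (i ∸ suc t′)) ×-dec (y (i ∸ suc t′) <? v)) t
    ...   | yes (t′ , t′<t , j≤yd , yd<v) = i ∸ suc t′ , b , ≤-trans (≤-reflexive (sym (∸-suc t′<i))) (m∸n≤m i t′) , i≤b , b<n , <-≤-trans yd<v v≤yb , avoid
      where
        t′<i : t′ < i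
        t′<i = <-≤-trans t′<t (≤-trans t≤ta (<⇒≤ ta<i))
        avoid : ∀ r s → i ∸ suc t′ < r → r ≤ b → y (i ∸ suc t′) < s → s ≤ y b → ¬ V r s
        avoid r s d<r r≤b yd<s s≤yb xrs with i ≤? r
        ... | yes i≤r = free₊ r s i≤r r≤b (≤-trans j≤yd (<⇒≤ yd<s)) s≤yb xrs
        -- A box of `V` here would be an obstruction nearer to p than the nearest one.
        ... | no i≰r  = first (i ∸ r) (≤-<-trans (row₋ t′<i d<r (<⇒≤ (≰⇒> i≰r))) t′<t)
                          (m<n⇒0<n∸m (≰⇒> i≰r) , s , s≤s s≤yb , ≤-<-trans j≤yd yd<s , subst (λ u → V u s) (sym (m∸[m∸n]≡n (<⇒≤ (≰⇒> i≰r)))) xrs)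
    ...   | no none = ⊥-elim (starved₋ g t v (≤-trans t≤ta (<⇒≤ ta<i)) (≰⇒> e≰u) (<⇒≤ j<v) v≤n
                        (onX (i ∸ t) v (≤-trans (m∸n≤m i t) (<⇒≤ i<n)) v≤n x)
                        (λ t′ t′<t y<v → hit₋ (proj₂ (proj₂ (proj₂ first₋)) t′ (<-≤-trans t′<t t≤ta)) (≰⇒> λ j≤y → none (t′ , t′<t , j≤y , y<v))) h₋)
      where
        v≤n : v ≤ n
        v≤n = ≤-trans v≤yb (<⇒≤ (bounded b b<n))

    -- The mirror image of `slide-down`: `a` is kept, and `b` is replaced by a point between p and
    -- the nearest obstruction in the lower right block. `Inv₊` holds at every distance, so its
    -- failure settles the remaining case.
    slide-up : ∀ {t v} → t ≤ tb → 0 < t → v < j → y a < v → V (i + t) v → (∀ k → k < t → ¬ SE k) → Swap y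
    slide-up {t} {v} t≤tb 0<t v<j ya<v x first with anyUpTo? (λ t′ → (v ≤? y (i + t′)) ×-dec (y (i + t′) <? j)) t
    ... | yes (t′ , t′<t , v≤yd , yd<j) = a , i + t′ , a<i , m≤m+n i t′ , <-≤-trans (+-monoʳ-< i t′<t) i+t≤n , <-≤-trans ya<v v≤yd , avoid
      where
        i+t≤n : i + t ≤ n
        i+t≤n = ≤-trans (+-monoʳ-≤ i t≤tb) (<⇒≤ b<n)
        avoid : ∀ r s → a < r → r ≤ i + t′ → y a < s → s ≤ y (i + t′) → ¬ V r s
        avoid r s a<r r≤d ya<s s≤yd xrs with r ≤? i
        ... | yes r≤i = free₋ r s a<r r≤i ya<s (≤-trans s≤yd (<⇒≤ yd<j)) xrs
        ... | no r≰i  = first (r ∸ i) (≤-<-trans (≤-trans (∸-monoˡ-≤ i r≤d) (≤-reflexive (m+n∸m≡n i t′))) t′<t)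
                          (m<n⇒0<n∸m (≰⇒> r≰i) , s , ≤-<-trans s≤yd yd<j , ya<s , subst (λ u → V u s) (sym (m+[n∸m]≡n (<⇒≤ (≰⇒> r≰i)))) xrs)
    ... | no none = ⊥-elim (starved₊ g t v 0<t (≤-trans (+-monoʳ-≤ i t≤tb) (<⇒≤ b<n)) (<⇒≤ v<j) x
                      (λ t′ t′<t v≤y → hit₊ (proj₂ (proj₂ (proj₂ first₊)) t′ (<-≤-trans t′<t t≤tb)) (≮⇒≥ λ y<j → none (t′ , t′<t , v≤y , y<j))) h₊)

    step : Swap y
    step with least nw? (suc ta)
    ... | inj₂ (t , t<1+ta , (0<t , v , v<1+yb , j<v , x) , first) = slide-down (≤-pred t<1+ta) 0<t (≤-pred v<1+yb) j<v x first
    ... | inj₁ no-nw with least se? (suc tb)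
    ...   | inj₂ (t , t<1+tb , (0<t , v , v<j , ya<v , x) , first) = slide-up (≤-pred t<1+tb) 0<t v<j ya<v x first
    -- p cuts the rectangle of `a` and `b` into four blocks: two are clear because `a` and `b` are
    -- free, two because there is no obstruction.
    ...   | inj₁ no-se = a , b , a<i , i≤b , b<n , <-≤-trans ya<j j≤yb , avoid
      where
        avoid : ∀ r s → a < r → r ≤ b → y a < s → s ≤ y b → ¬ V r s
        avoid r s a<r r≤b ya<s s≤yb x with r ≤? i | s ≤? j
        ... | yes r≤i | yes s≤j = free₋ r s a<r r≤i ya<s s≤j x
        ... | yes r≤i | no s≰j with i ≤? r
        ...   | yes i≤r = free₊ r s i≤r r≤b (<⇒≤ (≰⇒> s≰j)) s≤yb x
        ...   | no i≰r  = no-nw (i ∸ r) (s≤s (row₋ ta<i a<r r≤i))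
                            (m<n⇒0<n∸m (≰⇒> i≰r) , s , s≤s s≤yb , ≰⇒> s≰j , subst (λ u → V u s) (sym (m∸[m∸n]≡n r≤i)) x)
        avoid r s a<r r≤b ya<s s≤yb x | no r≰i | _ with j ≤? s
        ...   | yes j≤s = free₊ r s (<⇒≤ (≰⇒> r≰i)) r≤b j≤s s≤yb x
        ...   | no j≰s  = no-se (r ∸ i) (s≤s (≤-trans (∸-monoˡ-≤ i r≤b) (≤-reflexive (m+n∸m≡n i tb))))
                            (m<n⇒0<n∸m (≰⇒> r≰i) , s , ≰⇒> j≰s , ya<s , subst (λ u → V u s) (sym (m+[n∸m]≡n (<⇒≤ (≰⇒> r≰i)))) x)

  descent : ∀ fuel y → total n y < fuel → Good y → Inv₋ y → ¬ Inv₊ y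
  descent (suc fuel) y t<f g h₋ h₊ with FindSwap.step g h₋ h₊
  ... | c , d , c<i , i≤d , d<n , yc<yd , avoid =
    descent fuel (sw c d y) (<-≤-trans (total-sw c<d d<n yc<yd (Good.bounded g d d<n)) (≤-pred t<f)) (move g c<d d<n yc<yd avoid)
      (Exchange.inv₋ c<i i≤d yc<yd h₋) (Exchange.inv₊ c<i i≤d yc<yd h₊)
    where
      c<d : c < d
      c<d = <-≤-trans c<i i≤d

-- Sets of boxes closed under influence

<∸-swap : ∀ j s c → s < j ∸ c → c < j ∸ s
<∸-swap j s c h = 0<n∸m⇒m<n c (subst (0 <_) (trans (∸-+-assoc j c s) (trans (cong (j ∸_) (+-comm c s)) (sym (∸-+-assoc j s c)))) (m<n⇒0<n∸m h))

<suc∸⇒ : ∀ {s c} j → s < suc c ∸ j → j + s ≤ c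
<suc∸⇒ {s} {c} j h = ≤-pred (subst (_≤ suc c) (+-suc j s) (≤-trans (+-monoʳ-≤ j h) (≤-reflexive (m+[n∸m]≡n (<⇒≤ (0<n∸m⇒m<n j (≤-<-trans z≤n h)))))))

⇒<suc∸ : ∀ {s c} j → j + s ≤ c → s < suc c ∸ j
⇒<suc∸ {s} {c} j h = subst (_≤ suc c ∸ j) (trans (cong (_∸ j) (sym (+-suc j s))) (m+n∸m≡n j (suc s))) (∸-monoˡ-≤ j (s≤s h))

rank-zero : ∀ y u → rank y u 0 ≡ 0
rank-zero y u = sumTo-zero u λ c _ → lt-no {y c} z≤n

+∸-≤ : ∀ {i n t} → i ≤ n → t ≤ n ∸ i → i + t ≤ n
+∸-≤ {i} i≤n t≤T = ≤-trans (+-monoʳ-≤ i t≤T) (≤-reflexive (m+[n∸m]≡n i≤n))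

-- The form in which D_w = 0 is obtained: two rank increments over the same positions both equal
-- `k`.
square : ∀ {p q r s k} → p ≡ q + k → r ≡ s + k → p + s ≡ r + q
square {q = q} {s = s} {k} refl refl = trans (+-assoc q k s) (trans (cong (q +_) (+-comm k s)) (+-comm q (s + k)))

module Closed (n : ℕ) (w x : ℕ → ℕ) (w<n : Bounded n w) (x<n : Bounded n x) (le : RankLe n w x) (sv : SameValues n x w)
              (J : ℕ → ℕ → Set) (J? : ∀ u v → Dec (J u v))
              (V⇒J : ∀ u v → u ≤ n → v ≤ n → rank x u v ≡ rank w u v → J u v)
              (rule : ∀ u v u′ v′ → u ≤ n → v ≤ n → u′ ≤ n → v′ ≤ n → (u′ < u × v′ < v) ⊎ (u < u′ × v < v′)
                    → rank x u′ v′ ≡ rank w u′ v′ → J u v′ → J u′ v → rank w u v + rank w u′ v′ ≡ rank w u v′ + rank w u′ v → J u v)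
              (few : Admissible.M n w (λ u v → rank x u v ≡ rank w u v) (λ u v → rank x u v ≟ rank w u v) x ≤ Total.M n w w) where

  V : ℕ → ℕ → Set
  V u v = rank x u v ≡ rank w u v

  V? : ∀ u v → Dec (V u v)
  V? u v = rank x u v ≟ rank w u v

  f : ℕ → ℕ → ℕ
  f u v = rank x u v ∸ rank w u v

  V⇒0 : ∀ {u v} → V u v → f u v ≡ 0
  V⇒0 {u} {v} eq = trans (cong (_∸ rank w u v) eq) (n∸n≡0 (rank w u v))

  0⇒V : ∀ {u v} → u ≤ n → v ≤ n → f u v ≡ 0 → V u v
  0⇒V {u} {v} u≤n v≤n eq = ≤-antisym (m∸n≡0⇒m≤n eq) (le u v u≤n v≤n)

  f-step : ∀ u v → u < n → v ≤ n → f (suc u) v + lt (w u) v ≡ f u v + lt (x u) v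
  f-step u v u<n v≤n = +-cancelʳ-≡ (rank w u v) _ _ (begin
    (f (suc u) v + lt (w u) v) + rank w u v ≡⟨ +-assoc (f (suc u) v) _ _ ⟩
    f (suc u) v + (lt (w u) v + rank w u v) ≡⟨ cong (f (suc u) v +_) (+-comm (lt (w u) v) _) ⟩
    f (suc u) v + rank w (suc u) v          ≡⟨ m∸n+n≡m (le (suc u) v u<n v≤n) ⟩
    rank x u v + lt (x u) v                 ≡⟨ cong (_+ lt (x u) v) (sym (m∸n+n≡m (le u v (<⇒≤ u<n) v≤n))) ⟩
    (f u v + rank w u v) + lt (x u) v       ≡⟨ +-assoc (f u v) _ _ ⟩
    f u v + (rank w u v + lt (x u) v)       ≡⟨ cong (f u v +_) (+-comm (rank w u v) _) ⟩
    f u v + (lt (x u) v + rank w u v)       ≡⟨ sym (+-assoc (f u v) _ _) ⟩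
    (f u v + lt (x u) v) + rank w u v ∎)
    where open ≡-Reasoning

  -- The upper right quadrant counts points at or above a height, so `f-step` is passed to
  -- complements by means of `lt+ge`.
  f-step-ge : ∀ u v → u < n → v ≤ n → f u v + ge (w u) v ≡ f (suc u) v + ge (x u) v
  f-step-ge u v u<n v≤n = +-cancelʳ-≡ (lt (x u) v + lt (w u) v) _ _ (begin
    (f u v + ge (w u) v) + (lt (x u) v + lt (w u) v) ≡⟨ +-interchange (f u v) _ _ _ ⟩
    (f u v + lt (x u) v) + (ge (w u) v + lt (w u) v) ≡⟨ cong₂ _+_ (sym (f-step u v u<n v≤n)) (trans (+-comm (ge (w u) v) _) (lt+ge (w u) v)) ⟩
    (f (suc u) v + lt (w u) v) + 1                   ≡⟨ cong ((f (suc u) v + lt (w u) v) +_) (sym (trans (+-comm (ge (x u) v) _) (lt+ge (x u) v))) ⟩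
    (f (suc u) v + lt (w u) v) + (ge (x u) v + lt (x u) v) ≡⟨ +-interchange (f (suc u) v) _ _ _ ⟩
    (f (suc u) v + ge (x u) v) + (lt (w u) v + lt (x u) v) ≡⟨ cong ((f (suc u) v + ge (x u) v) +_) (+-comm (lt (w u) v) _) ⟩
    (f (suc u) v + ge (x u) v) + (lt (x u) v + lt (w u) v) ∎)
    where open ≡-Reasoning

  V-bottom : ∀ u → V u 0
  V-bottom u = trans (rank-zero x u) (sym (rank-zero w u))

  V-top : ∀ u → u ≤ n → V u n
  V-top u u≤n = sumTo-cong u λ c c<u → trans (lt-yes (x<n c (<-≤-trans c<u u≤n))) (sym (lt-yes (w<n c (<-≤-trans c<u u≤n))))

  balance₋ : ∀ {i j} → i ≤ n → j ≤ n → ∀ t s → t < i → s ≤ j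
           → f (i ∸ t) (j ∸ s) + lt s (j ∸ w (i ∸ suc t)) ≡ f (i ∸ suc t) (j ∸ s) + lt s (j ∸ x (i ∸ suc t))
  balance₋ {i} {j} i≤n j≤n t s t<i s≤j = begin
    f (i ∸ t) v + lt s (j ∸ w u) ≡⟨ cong₂ (λ a b → f a v + b) (∸-suc t<i) (lt-cong (<∸-swap j s (w u)) (<∸-swap j (w u) s)) ⟩
    f (suc u) v + lt (w u) v     ≡⟨ f-step u v (≤-trans (≤-reflexive (sym (∸-suc t<i))) (≤-trans (m∸n≤m i t) i≤n)) (≤-trans (m∸n≤m j s) j≤n) ⟩
    f u v + lt (x u) v           ≡⟨ cong (f u v +_) (lt-cong (<∸-swap j (x u) s) (<∸-swap j s (x u))) ⟩
    f u v + lt s (j ∸ x u) ∎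
    where
      open ≡-Reasoning
      u = i ∸ suc t
      v = j ∸ s

  balance₊ : ∀ {i j} → i ≤ n → j ≤ n → ∀ t s → t < n ∸ i → s ≤ n ∸ j
           → f (i + t) (j + s) + lt s (suc (w (i + t)) ∸ j) ≡ f (i + suc t) (j + s) + lt s (suc (x (i + t)) ∸ j)
  balance₊ {i} {j} i≤n j≤n t s t<T s≤S = begin
    f u v + lt s (suc (w u) ∸ j)         ≡⟨ cong (f u v +_) (𝟙-cong (s <? suc (w u) ∸ j) (v ≤? w u) (<suc∸⇒ j) (⇒<suc∸ j)) ⟩
    f u v + ge (w u) v                   ≡⟨ f-step-ge u v (≤-trans (≤-reflexive (sym (+-suc i t))) (+∸-≤ i≤n t<T)) (+∸-≤ j≤n s≤S) ⟩
    f (suc u) v + ge (x u) v             ≡⟨ cong₂ (λ a b → f a v + b) (sym (+-suc i t)) (𝟙-cong (v ≤? x u) (s <? suc (x u) ∸ j) (⇒<suc∸ j) (<suc∸⇒ j)) ⟩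
    f (i + suc t) v + lt s (suc (x u) ∸ j) ∎
    where
      open ≡-Reasoning
      u = i + t
      v = j + s

  module Quadrants (i j : ℕ) (i≤n : i ≤ n) (j≤n : j ≤ n) where

    u₋≤ : ∀ t → i ∸ t ≤ n
    u₋≤ t = ≤-trans (m∸n≤m i t) i≤n

    v₋≤ : ∀ s → j ∸ s ≤ n
    v₋≤ s = ≤-trans (m∸n≤m j s) j≤n

    Z₋ Z₊ J₋ J₊ : ℕ → ℕ → Set
    Z₋ t s = V (i ∸ t) (j ∸ s)
    Z₊ t s = V (i + t) (j + s)
    J₋ t s = J (i ∸ t) (j ∸ s)
    J₊ t s = J (i + t) (j + s)

    0⇒Z₋ : ∀ {t s} → t ≤ i → s ≤ j → f (i ∸ t) (j ∸ s) ≡ 0 → Z₋ t s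
    0⇒Z₋ {t} {s} _ _ = 0⇒V (u₋≤ t) (v₋≤ s)

    0⇒Z₊ : ∀ {t s} → t ≤ n ∸ i → s ≤ n ∸ j → f (i + t) (j + s) ≡ 0 → Z₊ t s
    0⇒Z₊ t≤T s≤S = 0⇒V (+∸-≤ i≤n t≤T) (+∸-≤ j≤n s≤S)

    Z₋⇒0 : ∀ {t s} → t ≤ i → s ≤ j → Z₋ t s → f (i ∸ t) (j ∸ s) ≡ 0
    Z₋⇒0 {t} {s} _ _ = V⇒0 {i ∸ t} {j ∸ s}

    Z₊⇒0 : ∀ {t s} → t ≤ n ∸ i → s ≤ n ∸ j → Z₊ t s → f (i + t) (j + s) ≡ 0
    Z₊⇒0 {t} {s} _ _ = V⇒0 {i + t} {j + s}

    edge₋ : ∀ t → t ≤ i → Z₋ t j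
    edge₋ t _ = subst (V (i ∸ t)) (sym (n∸n≡0 j)) (V-bottom (i ∸ t))

    edge₊ : ∀ t → t ≤ n ∸ i → Z₊ t (n ∸ j)
    edge₊ t t≤T = subst (V (i + t)) (sym (m+[n∸m]≡n j≤n)) (V-top (i + t) (+∸-≤ i≤n t≤T))

    Z₋⇒J : ∀ {t s} → t ≤ i → s ≤ j → Z₋ t s → J₋ t s
    Z₋⇒J {t} {s} _ _ = V⇒J (i ∸ t) (j ∸ s) (u₋≤ t) (v₋≤ s)

    Z₊⇒J : ∀ {t s} → t ≤ n ∸ i → s ≤ n ∸ j → Z₊ t s → J₊ t s
    Z₊⇒J {t} {s} t≤T s≤S = V⇒J (i + t) (j + s) (+∸-≤ i≤n t≤T) (+∸-≤ j≤n s≤S)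

    -- By `deep`, at the positions between `i ∸ t` and `i` the function w takes no value from
    -- `j ∸ s′` up to, but excluding, `j ∸ s`. The rank increments at these two heights therefore
    -- agree, which is the vanishing of D_w.
    rule₋ : ∀ t s s′ → 0 < t → t ≤ i → s < s′ → s′ ≤ j → Z₋ t s′ → J₋ t s → J₋ 0 s′
          → (∀ t′ → t′ < t → s < j ∸ w (i ∸ suc t′) → s′ < j ∸ w (i ∸ suc t′)) → J₋ 0 s
    rule₋ t s s′ 0<t t≤i s<s′ s′≤j z J₁ J₂ deep = rule i (j ∸ s) (i ∸ t) (j ∸ s′) i≤n (v₋≤ s) (u₋≤ t) (v₋≤ s′)
      (inj₁ (∸-monoʳ-< 0<t t≤i , ∸-monoʳ-< s<s′ s′≤j)) z J₂ J₁
      (square (rank-down w i (j ∸ s) t t≤i) (trans (rank-down w i (j ∸ s′) t t≤i) (cong (rank w (i ∸ t) (j ∸ s′) +_) (sumTo-cong t λ t′ t′<t →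
        lt-cong (λ wc<v′ → <-≤-trans wc<v′ (∸-monoʳ-≤ j (<⇒≤ s<s′))) (λ wc<v → <∸-swap j s′ _ (deep t′ t′<t (<∸-swap j _ s wc<v)))))))

    rule₊ : ∀ t s s′ → 0 < t → t ≤ n ∸ i → s < s′ → s′ ≤ n ∸ j → Z₊ t s′ → J₊ t s → J₊ 0 s′
          → (∀ t′ → t′ < t → s < suc (w (i + t′)) ∸ j → s′ < suc (w (i + t′)) ∸ j) → J₊ 0 s
    rule₊ t s s′ 0<t t≤T s<s′ s′≤S z J₁ J₂ deep = subst (λ u → J u (j + s)) (sym (+-identityʳ i))
      (rule i (j + s) (i + t) (j + s′) i≤n (+∸-≤ j≤n (≤-trans (<⇒≤ s<s′) s′≤S)) (+∸-≤ i≤n t≤T) (+∸-≤ j≤n s′≤S)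
        (inj₂ (subst (_< i + t) (+-identityʳ i) (+-monoʳ-< i 0<t) , +-monoʳ-< j s<s′)) z (subst (λ u → J u (j + s′)) (+-identityʳ i) J₂) J₁
        (trans (+-comm (rank w i (j + s)) _) (trans (square (trans (rank-up w i (j + s′) t) (cong (rank w i (j + s′) +_) (sumTo-cong t λ t′ t′<t →
            lt-cong (λ wc<v′ → ≰⇒> λ v≤wc → <⇒≱ wc<v′ (<suc∸⇒ j (deep t′ t′<t (⇒<suc∸ j v≤wc)))) (λ wc<v → <-≤-trans wc<v (+-monoʳ-≤ j (<⇒≤ s<s′))))))
          (rank-up w i (j + s) t)) (+-comm (rank w (i + t) (j + s)) _))))

    module Lower = Sweep i j (λ t s → f (i ∸ t) (j ∸ s)) Z₋ (λ t s → V? (i ∸ t) (j ∸ s)) Z₋⇒0 0⇒Z₋ edge₋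
      (λ t → j ∸ x (i ∸ suc t)) (λ t → j ∸ w (i ∸ suc t)) (balance₋ i≤n j≤n) J₋ Z₋⇒J rule₋

    module Upper = Sweep (n ∸ i) (n ∸ j) (λ t s → f (i + t) (j + s)) Z₊ (λ t s → V? (i + t) (j + s)) Z₊⇒0 0⇒Z₊ edge₊
      (λ t → suc (x (i + t)) ∸ j) (λ t → suc (w (i + t)) ∸ j) (balance₊ i≤n j≤n) J₊ Z₊⇒J rule₊

  V-last : ∀ j → j ≤ n → V n j
  V-last = sv

  -- At positions from e to i, V has no point between height j and the first V-point above (i , j).
  Mid : ℕ → ℕ → ℕ → Set
  Mid j e i = ∀ r v → e ≤ r → r < i → j ≤ v → (∀ v′ → j ≤ v′ → v′ ≤ v → ¬ V i v′) → ¬ V r v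

  -- Keep moving left to boxes outside `J` whose `f` is no larger. At the end every such box further
  -- left has strictly larger `f`, which is what rules out a failure of `Inv₋`.
  leftmost : ∀ fuel j i → i < fuel → ¬ J i j → ∃ λ e → e ≤ i × ¬ J e j × (∀ u → u < e → ¬ J u j → f e j < f u j)
  leftmost (suc fuel) j i i<fuel ¬J with anyUpTo? (λ u → ¬? (J? u j) ×-dec (f u j ≤? f i j)) i
  ... | yes (u , u<i , ¬Ju , fu≤fi) with leftmost fuel j u (<-≤-trans u<i (≤-pred i<fuel)) ¬Ju
  ...   | e , e≤u , rest = e , ≤-trans e≤u (<⇒≤ u<i) , rest
  leftmost (suc fuel) j i i<fuel ¬J | no none = i , ≤-refl , ¬J , λ u u<i ¬Ju → ≰⇒> λ fu≤fi → none (u , u<i , ¬Ju , fu≤fi)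

  module Row (j e : ℕ) (j≤n : j ≤ n) (0<e : 0 < e) (lowest : ∀ u → u < e → ¬ J u j → f e j < f u j) where

    module At (i : ℕ) (i<n : i < n) (e≤i : e ≤ i) (mid : Mid j e i) =
      Descent n w w<n V V? V-last i j e i<n j≤n 0<e e≤i mid

    J-last : ¬ J n j → ⊥
    J-last ¬J = ¬J (V⇒J n j ≤-refl j≤n (V-last j j≤n))

    -- A failure of Inv₊ at p exhibits another box to the right of p, at the same height, that is not influenced.
    chain : ∀ fuel i → n ∸ i < fuel → e ≤ i → i ≤ n → ¬ J i j → f i j ≤ f e j → Mid j e i → ⊥
    chain (suc fuel) i fuel> e≤i i≤n ¬J fi≤fe mid = case anyUpTo? (λ t → (0 <? t) ×-dec (inside₊ w t ≤? blocked₊ x t)) (suc (n ∸ i)) of λ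
      { (no none) → descent (suc (total n x)) x ≤-refl good inv₋
          (λ t 0<t i+t≤n → ≰⇒> λ h → none (t , s≤s (≤-trans (≤-reflexive (sym (m+n∸m≡n i t))) (∸-monoˡ-≤ i i+t≤n)) , 0<t , h))
      ; (yes (t , t<1+T , 0<t , h)) → advance t (≤-pred t<1+T) 0<t (Quadrants.Upper.sweep i j i≤n j≤n t 0<t (≤-pred t<1+T) h
          (¬J ∘ subst₂ J (+-identityʳ i) (+-identityʳ j))) }
      where
        i<n : i < n
        i<n = ≤∧≢⇒< i≤n λ { refl → J-last ¬J }
        open At i i<n e≤i mid
        open Reachable n w w<n V V? V-last using (Good)
        good : Good x
        good = record { bounded = x<n ; le = le ; onX = λ _ _ _ _ h → h ; few = few }
        -- A failure would let the sweep produce a box left of `e`, outside `J`, with `f` at most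
        -- its value at `e`, against `lowest`.
        inv₋ : Inv₋ x
        inv₋ t t≤i u<e = ≰⇒> λ h → case Quadrants.Lower.sweep i j i≤n j≤n t (0<t t u<e) t≤i h ¬J of λ
          { (¬Ju , fu≤fi , _) → <⇒≱ (lowest (i ∸ t) u<e ¬Ju) (≤-trans fu≤fi fi≤fe) }
          where
            0<t : ∀ t → i ∸ t < e → 0 < t
            0<t zero    i<e = ⊥-elim (<⇒≱ i<e e≤i)
            0<t (suc _) _   = z<s
        advance : ∀ t → t ≤ n ∸ i → 0 < t → _ → ⊥
        advance t t≤T 0<t (¬Jt , ft≤fi , σ , σ≤S , z , clear) = chain fuel (i + t)
          (<-≤-trans (∸-monoʳ-< i<i+t (+∸-≤ i≤n t≤T)) (≤-pred fuel>)) (≤-trans e≤i (m≤m+n i t)) (+∸-≤ i≤n t≤T)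
          (¬Jt ∘ subst (J (i + t)) (sym (+-identityʳ j)))
          (≤-trans (subst₂ (λ v v′ → f (i + t) v ≤ f (i + 0) v′) (+-identityʳ j) (+-identityʳ j) ft≤fi) (subst (λ u → f u j ≤ f e j) (sym (+-identityʳ i)) fi≤fe))
          mid′
          where
            i<i+t : i < i + t
            i<i+t = subst (_< i + t) (+-identityʳ i) (+-monoʳ-< i 0<t)
            -- Since (i + t , j + σ) lies in `V`, the assumption `free` puts `v` below `j + σ`. Up
            -- to that height the sweep found columns `i` to `i + t ∸ 1` clear, and clearness of
            -- column `i` reduces the columns before it to `mid`.
            mid′ : Mid j e (i + t)
            mid′ r v e≤r r<i+t j≤v free with i ≤? r
            ... | yes i≤r = between r v i≤r r<i+t j≤v (v<h j≤v free)
              where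
                v<h : j ≤ v → (∀ v′ → j ≤ v′ → v′ ≤ v → ¬ V (i + t) v′) → v < j + σ
                v<h j≤v free = ≰⇒> λ h≤v → free (j + σ) (m≤m+n j σ) h≤v z
                between : ∀ r v → i ≤ r → r < i + t → j ≤ v → v < j + σ → ¬ V r v
                between r v i≤r r<i+t j≤v v<h xrv = clear (r ∸ i) (v ∸ j)
                  (subst (r ∸ i <_) (m+n∸m≡n i t) (∸-monoˡ-< r<i+t i≤r)) (subst (v ∸ j <_) (m+n∸m≡n j σ) (∸-monoˡ-< v<h j≤v))
                  (subst₂ V (sym (m+[n∸m]≡n i≤r)) (sym (m+[n∸m]≡n j≤v)) xrv)
            ... | no i≰r = mid r v e≤r (≰⇒> i≰r) j≤v λ v′ j≤v′ v′≤v xiv′ → clear 0 (v′ ∸ j) 0<t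
                (subst (v′ ∸ j <_) (m+n∸m≡n j σ) (∸-monoˡ-< (≤-<-trans v′≤v (≰⇒> λ h≤v → free (j + σ) (m≤m+n j σ) h≤v z)) j≤v′))
                (subst₂ V (sym (+-identityʳ i)) (sym (m+[n∸m]≡n j≤v′)) xiv′)

  -- Start `chain` at the box found by `leftmost`: with both ends at `e` the condition `Mid` is
  -- vacuous.
  everything : ∀ i j → i ≤ n → j ≤ n → J i j
  everything i j i≤n j≤n = decidable-stable (J? i j) λ ¬J → case leftmost (suc i) j i ≤-refl ¬J of λ
    { (e , e≤i , ¬Je , lowest) → Row.chain j e j≤n (0<e e ¬Je) lowest (suc (n ∸ e)) e ≤-refl ≤-refl (≤-trans e≤i i≤n) ¬Je ≤-refl
        λ r v e≤r r<e → ⊥-elim (<⇒≱ r<e e≤r) }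
    where
      0<e : ∀ e → ¬ J e j → 0 < e
      0<e zero    ¬J = ⊥-elim (¬J (V⇒J 0 j z≤n j≤n refl))
      0<e (suc _) _  = z<s

-- From permutations to functions on ℕ

sumTo-* : ∀ n k f → sumTo n (λ c → k * f c) ≡ k * sumTo n f
sumTo-* zero    k f = sym (*-zeroʳ k)
sumTo-* (suc n) k f = trans (cong (_+ k * f n) (sumTo-* n k f)) (sym (*-distribˡ-+ k _ _))

sumTo-δ : ∀ {n} c → c < n → sumTo n (λ d → 𝟙 (c ≟ d)) ≡ 1
sumTo-δ {n} c c<n = trans (sumTo-pull n c (λ d → 𝟙 (c ≟ d)) c<n) (cong₂ _+_ (𝟙-yes (c ≟ c) refl) (sumTo-zero n λ d _ → rest d))
  where
    rest : ∀ d → erase c (λ d → 𝟙 (c ≟ d)) d ≡ 0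
    rest d = case d ≟ c of λ
      { (yes refl) → erase-eq c (λ d → 𝟙 (c ≟ d))
      ; (no d≢c) → trans (erase-neq (λ d → 𝟙 (c ≟ d)) d≢c) (𝟙-no (c ≟ d) (d≢c ∘ sym)) }

sumTo-cut : ∀ {n i} f → i ≤ n → sumTo n (λ k → lt k i * f k) ≡ sumTo i f
sumTo-cut {zero}  {zero}  f z≤n = refl
sumTo-cut {suc n} {i} f i≤1+n = case i ≟ suc n of λ
  { (yes refl) → sumTo-cong (suc n) λ k k<1+n → trans (cong (_* f k) (lt-yes k<1+n)) (*-identityˡ (f k))
  ; (no i≢) → let i≤n = ≤-pred (≤∧≢⇒< i≤1+n i≢) in
      trans (cong₂ _+_ (sumTo-cut f i≤n) (cong (_* f n) (lt-no i≤n))) (+-identityʳ _) }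

sumFin-sumTo : ∀ {n} (f : Fin n → ℕ) (g : ℕ → ℕ) → (∀ u → f u ≡ g (toℕ u)) → sumFin f ≡ sumTo n g
sumFin-sumTo {zero}  f g h = refl
sumFin-sumTo {suc n} f g h = trans (cong₂ _+_ (h fzero) (sumFin-sumTo (f ∘ fsuc) (g ∘ suc) (h ∘ fsuc))) (sym (sumTo-front n g))

count-sumTo : ∀ {n} (f : Fin n → Bool) (g : ℕ → ℕ) → (∀ u → (if f u then 1 else 0) ≡ g (toℕ u)) → count f ≡ sumTo n g
count-sumTo {zero}  f g h = refl
count-sumTo {suc n} f g h = trans (cong₂ _+_ (h fzero) (count-sumTo (f ∘ fsuc) (g ∘ suc) (h ∘ fsuc))) (sym (sumTo-front n g))

𝟙-∧ : {P Q : Set} (p : Dec P) (q : Dec Q) → (if does p ∧ does q then 1 else 0) ≡ 𝟙 p * 𝟙 q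
𝟙-∧ (yes _) (yes _) = refl
𝟙-∧ (yes _) (no _)  = refl
𝟙-∧ (no _)  _       = refl

-- The identity beyond n lets `ext-sw` and `ext-≈` hold at all arguments without a bound.
ext : ∀ {n} → Perm n → ℕ → ℕ
ext {n} w k with k <? n
... | yes k<n = toℕ (w ⟨$⟩ʳ fromℕ< k<n)
... | no _    = k

ext-toℕ : ∀ {n} (w : Perm n) u → ext w (toℕ u) ≡ toℕ (w ⟨$⟩ʳ u)
ext-toℕ {n} w u with toℕ u <? n
... | yes u<n = cong (λ v → toℕ (w ⟨$⟩ʳ v)) (Fin.fromℕ<-toℕ u u<n)
... | no u≮n  = ⊥-elim (u≮n (Fin.toℕ<n u))

ext-≥ : ∀ {n} (w : Perm n) {k} → ¬ k < n → ext w k ≡ k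
ext-≥ {n} w {k} k≮n with k <? n
... | yes k<n = ⊥-elim (k≮n k<n)
... | no _    = refl

onFin : ∀ {n} (P : ℕ → Set) → (∀ (u : Fin n) → P (toℕ u)) → ∀ k → k < n → P k
onFin P h k k<n = subst P (Fin.toℕ-fromℕ< k<n) (h (fromℕ< k<n))

ext-bounded : ∀ {n} (w : Perm n) → Bounded n (ext w)
ext-bounded {n} w = onFin (λ k → ext w k < n) λ u → subst (_< n) (sym (ext-toℕ w u)) (Fin.toℕ<n (w ⟨$⟩ʳ u))

ext-≈ : ∀ {n} {w z : Perm n} → w ≈ z → ∀ k → ext w k ≡ ext z k
ext-≈ {n} {w} {z} h k = case k <? n of λ
  { (yes k<n) → onFin (λ k → ext w k ≡ ext z k) (λ u → trans (ext-toℕ w u) (trans (cong toℕ (h u)) (sym (ext-toℕ z u)))) k k<n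
  ; (no k≮n) → trans (ext-≥ w k≮n) (sym (ext-≥ z k≮n)) }

ext-injective : ∀ {n} (w : Perm n) → ∀ c d → c < n → d < n → ext w c ≡ ext w d → c ≡ d
ext-injective {n} w c d c<n d<n eq = trans (sym (Fin.toℕ-fromℕ< c<n)) (trans (cong toℕ
  (Injection.injective (↔⇒↣ w) (Fin.toℕ-injective (trans (sym (at c c<n)) (trans eq (at d d<n)))))) (Fin.toℕ-fromℕ< d<n))
  where
    at : ∀ k (k<n : k < n) → ext w k ≡ toℕ (w ⟨$⟩ʳ fromℕ< k<n)
    at k k<n = trans (cong (ext w) (sym (Fin.toℕ-fromℕ< k<n))) (ext-toℕ w (fromℕ< k<n))

transpose-l : ∀ {n} (a b : Fin n) → Components.transpose a b a ≡ b
transpose-l a b rewrite dec-true (a Fin.≟ a) refl = refl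

transpose-r : ∀ {n} (a b : Fin n) → Components.transpose a b b ≡ a
transpose-r a b with b Fin.≟ a
... | yes b≡a = b≡a
... | no _ rewrite dec-true (b Fin.≟ b) refl = refl

transpose-o : ∀ {n} (a b : Fin n) {k} → k ≢ a → k ≢ b → Components.transpose a b k ≡ k
transpose-o a b {k} k≢a k≢b rewrite dec-false (k Fin.≟ a) k≢a | dec-false (k Fin.≟ b) k≢b = refl

ext-sw : ∀ {n} (w : Perm n) a b k → ext (w ·t[ a , b ]) k ≡ sw (toℕ a) (toℕ b) (ext w) k
ext-sw {n} w a b k = case k <? n of λ
  { (yes k<n) → onFin (λ k → ext (w ·t[ a , b ]) k ≡ sw (toℕ a) (toℕ b) (ext w) k) on k k<n
  ; (no k≮n) → trans (ext-≥ (w ·t[ a , b ]) k≮n) (sym (trans (sw-o (toℕ a) (toℕ b) (ext w)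
      (λ { refl → k≮n (Fin.toℕ<n a) }) (λ { refl → k≮n (Fin.toℕ<n b) })) (ext-≥ w k≮n))) }
  where
    on : ∀ u → ext (w ·t[ a , b ]) (toℕ u) ≡ sw (toℕ a) (toℕ b) (ext w) (toℕ u)
    on u = trans (ext-toℕ (w ·t[ a , b ]) u) (case u Fin.≟ a of λ
      { (yes refl) → trans (cong (λ v → toℕ (w ⟨$⟩ʳ v)) (transpose-l a b)) (sym (trans (sw-l (toℕ a) (toℕ b) (ext w)) (ext-toℕ w b)))
      ; (no u≢a) → case u Fin.≟ b of λ
        { (yes refl) → trans (cong (λ v → toℕ (w ⟨$⟩ʳ v)) (transpose-r a b)) (sym (trans (sw-r (toℕ a) (toℕ b) (ext w)) (ext-toℕ w a)))
        ; (no u≢b) → trans (cong (λ v → toℕ (w ⟨$⟩ʳ v)) (transpose-o a b u≢a u≢b))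
            (sym (trans (sw-o (toℕ a) (toℕ b) (ext w) (u≢a ∘ Fin.toℕ-injective) (u≢b ∘ Fin.toℕ-injective)) (ext-toℕ w u))) } })

rk-rank : ∀ {n} (w : Perm n) {i} j → i ≤ n → rk w i j ≡ rank (ext w) i j
rk-rank {n} w {i} j i≤n = trans (count-sumTo _ (λ k → lt k i * lt (ext w k) j)
  (λ u → trans (𝟙-∧ (toℕ u <? i) (toℕ (w ⟨$⟩ʳ u) <? j)) (cong (λ v → lt (toℕ u) i * lt v j) (sym (ext-toℕ w u))))) (sumTo-cut (λ k → lt (ext w k) j) i≤n)

-- Length as a number of inversions

inv : (ℕ → ℕ) → ℕ → ℕ → ℕ
inv y a b = lt a b * lt (y b) (y a)

invs : ℕ → (ℕ → ℕ) → ℕ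
invs n y = sumTo n λ a → sumTo n λ b → inv y a b

len-invs : ∀ {n} (w : Perm n) → len w ≡ invs n (ext w)
len-invs {n} w = sumFin-sumTo _ (λ a → sumTo n λ b → inv (ext w) a b) λ a →
  count-sumTo _ (inv (ext w) (toℕ a)) λ b → trans (𝟙-∧ (toℕ a <? toℕ b) (toℕ (w ⟨$⟩ʳ b) <? toℕ (w ⟨$⟩ʳ a)))
    (cong₂ (λ p q → lt (toℕ a) (toℕ b) * lt p q) (sym (ext-toℕ w b)) (sym (ext-toℕ w a)))

inv-yes : ∀ {y a b} → a < b → inv y a b ≡ lt (y b) (y a)
inv-yes {y} {a} {b} a<b = trans (cong (_* lt (y b) (y a)) (lt-yes a<b)) (*-identityˡ _)

inv-no : ∀ {y a b} → b ≤ a → inv y a b ≡ 0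
inv-no {y} {a} {b} b≤a = cong (_* lt (y b) (y a)) (lt-no b≤a)

invs-cong : ∀ n {y z} → (∀ k → y k ≡ z k) → invs n y ≡ invs n z
invs-cong n h = sumTo-cong n λ a _ → sumTo-cong n λ b _ → cong₂ (λ p q → lt a b * lt p q) (h b) (h a)

-- For a third position c, the inversions it forms with `a` and `b` are at most redistributed or
-- gained. The pair (a , b) itself becomes an inversion, and this is the slack 1.
invs-sw : ∀ {n a b y} → a < b → b < n → y a < y b → invs n y < invs n (sw a b y)
invs-sw {n} {a} {b} {y} a<b b<n A<B = sumTo-mono₂ 1 n a b (<⇒≢ a<b) a<n b<n row rows
  where
    z = sw a b y
    a<n = <-trans a<b b<n
    za : z a ≡ y b
    za = sw-l a b y
    zb : z b ≡ y a
    zb = sw-r a b y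
    A≤B : ∀ {v} → lt v (y a) ≤ lt v (y b)
    A≤B = lt-mono λ h → <-trans h A<B
    B≤A : ∀ {v} → lt (y b) v ≤ lt (y a) v
    B≤A = lt-mono (<-trans A<B)
    off : ∀ {c} → c ≢ a → c ≢ b → z c ≡ y c
    off = sw-o a b y
    row : ∀ c → c < n → c ≢ a → c ≢ b → sumTo n (inv y c) ≤ sumTo n (inv z c)
    row c c<n c≢a c≢b = sumTo-mono₂ 0 n a b (<⇒≢ a<b) a<n b<n
      (λ d _ d≢a d≢b → ≤-reflexive (cong₂ (λ p q → lt c d * lt p q) (sym (off d≢a d≢b)) (sym zc)))
      (case c <? a of λ
        { (yes c<a) → let c<b = <-trans c<a a<b in begin
            inv y c a + inv y c b             ≡⟨ cong₂ _+_ (inv-yes {y} c<a) (inv-yes {y} c<b) ⟩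
            lt (y a) (y c) + lt (y b) (y c)   ≡⟨ +-comm (lt (y a) (y c)) _ ⟩
            lt (y b) (y c) + lt (y a) (y c)   ≡⟨ cong₂ _+_ (cong₂ lt (sym za) (sym zc)) (cong₂ lt (sym zb) (sym zc)) ⟩
            lt (z a) (z c) + lt (z b) (z c)   ≡⟨ sym (cong₂ _+_ (inv-yes {z} c<a) (inv-yes {z} c<b)) ⟩
            inv z c a + inv z c b ∎
        ; (no c≮a) → begin
            inv y c a + inv y c b ≡⟨ cong (_+ inv y c b) (inv-no {y} (≮⇒≥ c≮a)) ⟩
            lt c b * lt (y b) (y c) ≤⟨ *-monoʳ-≤ (lt c b) B≤A ⟩
            lt c b * lt (y a) (y c) ≡⟨ cong₂ (λ p q → lt c b * lt p q) (sym zb) (sym zc) ⟩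
            inv z c b ≤⟨ m≤n+m _ _ ⟩
            inv z c a + inv z c b ∎ })
      where
        open ≤-Reasoning
        zc = off c≢a c≢b
    cell : ∀ d → d < n → inv y a d + inv y b d ≤ inv z a d + inv z b d
    cell d _ = case d ≟ a of λ
      { (yes refl) → ≤-trans (≤-reflexive (cong₂ _+_ (inv-no {y} {d} ≤-refl) (inv-no {y} (<⇒≤ a<b)))) z≤n
      ; (no d≢a) → case d ≟ b of λ
        { (yes refl) → ≤-trans (≤-reflexive (cong₂ _+_ (trans (inv-yes {y} a<b) (lt-no (<⇒≤ A<B))) (inv-no {y} {d} ≤-refl))) z≤n
        ; (no d≢b) → let zd = off d≢a d≢b in case b <? d of λ
          { (yes b<d) → let a<d = <-trans a<b b<d in begin
              inv y a d + inv y b d           ≡⟨ cong₂ _+_ (inv-yes {y} a<d) (inv-yes {y} b<d) ⟩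
              lt (y d) (y a) + lt (y d) (y b) ≡⟨ +-comm (lt (y d) (y a)) _ ⟩
              lt (y d) (y b) + lt (y d) (y a) ≡⟨ cong₂ _+_ (cong₂ lt (sym zd) (sym za)) (cong₂ lt (sym zd) (sym zb)) ⟩
              lt (z d) (z a) + lt (z d) (z b) ≡⟨ sym (cong₂ _+_ (inv-yes {z} a<d) (inv-yes {z} b<d)) ⟩
              inv z a d + inv z b d ∎
          ; (no b≮d) → begin
              inv y a d + inv y b d   ≡⟨ cong (inv y a d +_) (inv-no {y} (≮⇒≥ b≮d)) ⟩
              inv y a d + 0           ≡⟨ +-identityʳ _ ⟩
              lt a d * lt (y d) (y a) ≤⟨ *-monoʳ-≤ (lt a d) A≤B ⟩
              lt a d * lt (y d) (y b) ≡⟨ cong₂ (λ p q → lt a d * lt p q) (sym zd) (sym za) ⟩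
              inv z a d               ≤⟨ m≤m+n _ _ ⟩
              inv z a d + inv z b d ∎ } } }
      where open ≤-Reasoning
    rows : 1 + (sumTo n (inv y a) + sumTo n (inv y b)) ≤ sumTo n (inv z a) + sumTo n (inv z b)
    rows = subst₂ _<_ (sumTo-+ n _ _) (sumTo-+ n _ _) (sumTo-strict n cell b b<n (begin-strict
      inv y a b + inv y b b ≡⟨ cong₂ _+_ (trans (inv-yes {y} a<b) (lt-no (<⇒≤ A<B))) (inv-no {y} {b} ≤-refl) ⟩
      0                     <⟨ z<s ⟩
      1                     ≡⟨ sym (trans (inv-yes {z} a<b) (trans (cong₂ lt zb za) (lt-yes A<B))) ⟩
      inv z a b             ≤⟨ m≤m+n _ _ ⟩
      inv z a b + inv z b b ∎))
      where open ≤-Reasoning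

len-up : ∀ {n} (y : Perm n) a b → toℕ a < toℕ b → ext y (toℕ a) < ext y (toℕ b) → len y < len (y ·t[ a , b ])
len-up {n} y a b a<b A<B = subst₂ _<_ (sym (len-invs y)) (sym (trans (len-invs (y ·t[ a , b ])) (invs-cong n (ext-sw y a b))))
  (invs-sw {y = ext y} a<b (Fin.toℕ<n b) A<B)

len-≈ : ∀ {n} {y z : Perm n} → (∀ k → ext y k ≡ ext z k) → len y ≡ len z
len-≈ {n} {y} {z} h = trans (len-invs y) (trans (invs-cong n h) (sym (len-invs z)))

-- Bruhat order and ranks

Raises : ∀ {n} → Perm n → Perm n → Set
Raises {n} y z = (∀ i j → rank (ext z) i j ≤ rank (ext y) i j) × (∀ j → rank (ext z) n j ≡ rank (ext y) n j)

raises-≗ : ∀ {n} {y z : Perm n} → (∀ k → ext z k ≡ ext y k) → Raises y z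
raises-≗ {n} h = (λ i j → ≤-reflexive (rank-cong i j λ c _ → h c)) , λ j → rank-cong n j λ c _ → h c

raises-trans : ∀ {n} {x y z : Perm n} → Raises x y → Raises y z → Raises x z
raises-trans (p , q) (p′ , q′) = (λ i j → ≤-trans (p′ i j) (p i j)) , λ j → trans (q′ j) (q j)

sw-back : ∀ a b y k → sw a b (sw a b y) k ≡ y k
sw-back a b y k = case k ≟ a of λ
  { (yes refl) → trans (sw-l k b _) (sw-r k b y)
  ; (no k≢a) → case k ≟ b of λ
    { (yes refl) → trans (sw-r a k _) (sw-l a k y)
    ; (no k≢b) → trans (sw-o a b _ k≢a k≢b) (sw-o a b y k≢a k≢b) } }

-- The order is defined through lengths, so a descent at `a`, `b` has to be excluded: then `y` would
-- come from `y ·t[ a , b ]` by exchanging an ascent and be the longer of the two, by `invs-sw`.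
raises-up : ∀ {n} (y : Perm n) a b → toℕ a < toℕ b → len y < len (y ·t[ a , b ]) → Raises y (y ·t[ a , b ])
raises-up {n} y a b a<b ℓ< with <-cmp (ext y (toℕ a)) (ext y (toℕ b))
... | tri< A<B _ _ = (λ i j → ≤-trans (≤-reflexive (rank-cong i j λ c _ → ext-sw y a b c)) (rank-sw-le (ext y) i j a<b (<⇒≤ A<B)))
                   , λ j → trans (rank-cong n j λ c _ → ext-sw y a b c) (rank-sw-> _ _ (ext y) n j (Fin.toℕ<n a) (Fin.toℕ<n b) (<⇒≢ a<b))
... | tri≈ _ A≡B _ = ⊥-elim (<⇒≢ a<b (ext-injective y _ _ (Fin.toℕ<n a) (Fin.toℕ<n b) A≡B))
... | tri> _ _ B<A = ⊥-elim (<-asym ℓ< (subst₂ _<_ (sym (trans (len-invs (y ·t[ a , b ])) (invs-cong n (ext-sw y a b)))) (sym (len-invs y))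
    (subst (invs n z <_) (invs-cong n (sw-back (toℕ a) (toℕ b) (ext y)))
      (invs-sw {n} {y = z} a<b (Fin.toℕ<n b) (subst₂ _<_ (sym (sw-l (toℕ a) (toℕ b) (ext y))) (sym (sw-r (toℕ a) (toℕ b) (ext y))) B<A)))))
  where
    z = sw (toℕ a) (toℕ b) (ext y)

ext-flip : ∀ {n} (y : Perm n) a b k → ext (y ·t[ a , b ]) k ≡ ext (y ·t[ b , a ]) k
ext-flip y a b k = trans (ext-sw y a b k) (trans (sw-comm (toℕ a) (toℕ b) (ext y) k) (sym (ext-sw y b a k)))

raises-step : ∀ {n} (y : Perm n) a b → len y < len (y ·t[ a , b ]) → Raises y (y ·t[ a , b ])
raises-step {n} y a b ℓ< with <-cmp (toℕ a) (toℕ b)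
... | tri< a<b _ _ = raises-up y a b a<b ℓ<
... | tri≈ _ a≡b _ = ⊥-elim (<-irrefl (len-≈ {y = y} {z = y ·t[ a , b ]} λ k → sym (trans (ext-sw y a b k)
        (subst (λ c → sw (toℕ a) c (ext y) k ≡ ext y k) a≡b (sw-id (toℕ a) (ext y) k)))) ℓ<)
... | tri> _ _ b<a = raises-trans {x = y} {y = y ·t[ b , a ]} {z = y ·t[ a , b ]}
        (raises-up y b a b<a (subst (len y <_) (len-≈ {y = y ·t[ a , b ]} {z = y ·t[ b , a ]} (ext-flip y a b)) ℓ<))
        (raises-≗ {y = y ·t[ b , a ]} {z = y ·t[ a , b ]} (ext-flip y a b))

≤B⇒raises : ∀ {n} {x w : Perm n} → x ≤B w → Raises x w
≤B⇒raises {x = x} {w} (≤B-refl x≈w) = raises-≗ {y = x} {z = w} λ k → sym (ext-≈ {w = x} {z = w} x≈w k)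
≤B⇒raises {x = x} {w} (≤B-step {y = y} a b x≤y ℓ< w≈) = raises-trans {x = x} {y = y} {z = w} (≤B⇒raises x≤y)
  (raises-trans {x = y} {y = y ·t[ a , b ]} {z = w} (raises-step y a b ℓ<) (raises-≗ {y = y ·t[ a , b ]} {z = w} (ext-≈ {w = w} {z = y ·t[ a , b ]} w≈)))

≤B-respʳ : ∀ {n} {x y z : Perm n} → x ≤B y → z ≈ y → x ≤B z
≤B-respʳ (≤B-refl x≈y) z≈y = ≤B-refl λ i → trans (x≈y i) (sym (z≈y i))
≤B-respʳ (≤B-step a b x≤y ℓ< y≈) z≈y = ≤B-step a b x≤y ℓ< λ i → trans (z≈y i) (y≈ i)

-- The converse of `≤B⇒raises`: the chain above `x` is prolonged at its upper end `y` by the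
-- exchanges that `ascend` finds, until `y` is `w`.
rankLe⇒≤B : ∀ {n} fuel (x y w : Perm n) → total n (ext y) < fuel → x ≤B y
          → RankLe n (ext w) (ext y) → SameValues n (ext y) (ext w) → x ≤B w
rankLe⇒≤B {n} (suc fuel) x y w t<f x≤y le sv with ascend n (ext w) (ext y) le (ext-bounded w) sv
... | inj₁ eq = ≤B-respʳ x≤y λ u → Fin.toℕ-injective (trans (sym (ext-toℕ w u)) (trans (sym (eq (toℕ u) (Fin.toℕ<n u))) (ext-toℕ y u)))
... | inj₂ (a , b , a<b , b<n , A<B , le′) = rankLe⇒≤B fuel x (y ·t[ a′ , b′ ]) w
    (subst (_< fuel) (sym total-eq) (<-≤-trans (total-sw a<b b<n A<B (ext-bounded y b b<n)) (≤-pred t<f)))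
    (≤B-step a′ b′ x≤y (len-up y a′ b′ (subst₂ _<_ (sym a≡) (sym b≡) a<b) (subst₂ (λ p q → ext y p < ext y q) (sym a≡) (sym b≡) A<B)) λ _ → refl)
    (λ i j i≤n j≤n → ≤-trans (le′ i j i≤n j≤n) (≤-reflexive (rank-cong i j λ c _ → sym (eq c))))
    (λ j j≤n → trans (rank-cong n j λ c _ → eq c) (sameValues-sw {y = ext y} {w = ext w} a<b b<n sv j j≤n))
  where
    a<n : a < n
    a<n = <-trans a<b b<n
    a′ b′ : Fin n
    a′ = fromℕ< a<n
    b′ = fromℕ< b<n
    a≡ : toℕ a′ ≡ a
    a≡ = Fin.toℕ-fromℕ< a<n
    b≡ : toℕ b′ ≡ b
    b≡ = Fin.toℕ-fromℕ< b<n
    eq : ∀ k → ext (y ·t[ a′ , b′ ]) k ≡ sw a b (ext y) k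
    eq k = trans (ext-sw y a′ b′ k) (cong₂ (λ p q → sw p q (ext y) k) a≡ b≡)
    total-eq : total n (ext (y ·t[ a′ , b′ ])) ≡ total n (sw a b (ext y))
    total-eq = sumTo-cong (suc n) λ i _ → sumTo-cong (suc n) λ j _ → rank-cong i j λ c _ → eq c

-- Counting the reflections of a smooth pair

occ : ∀ {n} → List (Fin n × Fin n) → ℕ → ℕ → ℕ
occ []            c d = 0
occ ((a , b) ∷ L) c d = 𝟙 (toℕ a ≟ c) * 𝟙 (toℕ b ≟ d) + occ L c d

occ-∈ : ∀ {n} {L : List (Fin n × Fin n)} {a b} → (a , b) ∈ L → 1 ≤ occ L (toℕ a) (toℕ b)
occ-∈ {a = a} {b} (here refl) = ≤-trans (≤-reflexive (sym (cong₂ _*_ (𝟙-yes (toℕ a ≟ toℕ a) refl) (𝟙-yes (toℕ b ≟ toℕ b) refl)))) (m≤m+n _ _)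
occ-∈ (there p) = ≤-trans (occ-∈ p) (m≤n+m _ _)

square-sum : ℕ → (ℕ → ℕ → ℕ) → ℕ
square-sum n f = sumTo n λ c → sumTo n (f c)

square-sum-+ : ∀ n f g → square-sum n (λ c d → f c d + g c d) ≡ square-sum n f + square-sum n g
square-sum-+ n f g = trans (sumTo-cong n λ c _ → sumTo-+ n (f c) (g c)) (sumTo-+ n _ _)

square-sum-flip : ∀ n f → square-sum n (λ c d → f d c) ≡ square-sum n f
square-sum-flip n f = sumTo-swap n n (λ c d → f d c)

square-sum-occ : ∀ {n} (L : List (Fin n × Fin n)) → square-sum n (occ L) ≡ length L
square-sum-occ {n} [] = sumTo-zero n λ c _ → sumTo-zero n λ _ _ → refl
square-sum-occ {n} ((a , b) ∷ L) = trans (square-sum-+ n (λ c d → 𝟙 (toℕ a ≟ c) * 𝟙 (toℕ b ≟ d)) (occ L)) (cong₂ _+_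
  (trans (sumTo-cong n λ c _ → trans (sumTo-* n (𝟙 (toℕ a ≟ c)) (λ d → 𝟙 (toℕ b ≟ d))) (trans (cong (𝟙 (toℕ a ≟ c) *_) (sumTo-δ (toℕ b) (Fin.toℕ<n b))) (*-identityʳ _)))
    (sumTo-δ (toℕ a) (Fin.toℕ<n a)))
  (square-sum-occ L))

-- A table laid out like that of `M`: ones on the diagonal and, on both sides of it, at the
-- inversions of `y`. Its sum is n + 2 ℓ(y).
reflections : (ℕ → ℕ) → ℕ → ℕ → ℕ
reflections y c d = 𝟙 (c ≟ d) + (inv y c d + inv y d c)

square-sum-reflections : ∀ n y → square-sum n (reflections y) ≡ n + (invs n y + invs n y)
square-sum-reflections n y = trans (square-sum-+ n (λ c d → 𝟙 (c ≟ d)) _) (cong₂ _+_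
  (trans (sumTo-cong n λ c c<n → sumTo-δ c c<n) (trans (sumTo-const n 1) (*-identityʳ n)))
  (trans (square-sum-+ n (inv y) _) (cong (invs n y +_) (square-sum-flip n (inv y)))))

reflections-≡ : ∀ y c → reflections y c c ≡ 1
reflections-≡ y c = cong₂ _+_ (𝟙-yes (c ≟ c) refl) (cong₂ _+_ (inv-no {y} {c} ≤-refl) (inv-no {y} {c} ≤-refl))

reflections-< : ∀ y {c d} → c < d → reflections y c d ≡ lt (y d) (y c)
reflections-< y {c} {d} c<d = trans (cong₂ _+_ (𝟙-no (c ≟ d) (<⇒≢ c<d)) (cong₂ _+_ (inv-yes {y} c<d) (inv-no {y} (<⇒≤ c<d)))) (+-identityʳ _)

reflections-sym : ∀ y c d → reflections y c d ≡ reflections y d c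
reflections-sym y c d = cong₂ _+_ (𝟙-cong (c ≟ d) (d ≟ c) sym sym) (+-comm (inv y c d) _)

-- Undoing an inversion of `w` gives an element below `w`, hence an admissible one.
reflections≤M : ∀ n w → n + (invs n w + invs n w) ≤ Total.M n w w
reflections≤M n w = subst (_≤ Total.M n w w) (square-sum-reflections n w) (sumTo-mono n λ c _ → sumTo-mono n λ d _ → entry c d)
  where
    open Total n w
    adm-w : Adm w
    adm-w _ _ _ = ≤-refl
    ordered : ∀ c d → c < d → reflections w c d ≤ 𝟙 (adm? (sw c d w))
    ordered c d c<d = ≤-trans (≤-reflexive (reflections-< w c<d)) (𝟙-mono (w d <? w c) (adm? _) λ D<C →
      adm-dom c<d (subst₂ _≤_ (sym (sw-l c d w)) (sym (sw-r c d w)) (<⇒≤ D<C)) (λ k → sym (sw-back c d w k)) adm-w)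
    entry : ∀ c d → reflections w c d ≤ 𝟙 (adm? (sw c d w))
    entry c d with <-cmp c d
    ... | tri< c<d _ _ = ordered c d c<d
    ... | tri≈ _ refl _ = ≤-reflexive (trans (reflections-≡ w c) (sym (𝟙-yes (adm? _) (adm-cong′ (λ k → sym (sw-id c w k)) adm-w))))
    ... | tri> _ _ d<c = ≤-trans (≤-reflexive (reflections-sym w c d)) (≤-trans (ordered d c d<c) (𝟙-mono (adm? _) (adm? _) (adm-cong′ (sw-comm d c w))))

minus-shift : ∀ {k a b} → ℤ.+ k ≡ ℤ.+ a ℤ.- ℤ.+ b → b + k ≡ a
minus-shift {k} {a} {b} eq = ℤ.+-injective (begin
  ℤ.+ (b + k)                       ≡⟨ cong ℤ.+_ (+-comm b k) ⟩
  ℤ.+ k ℤ.+ ℤ.+ b                   ≡⟨ cong (λ z → z ℤ.+ ℤ.+ b) eq ⟩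
  (ℤ.+ a ℤ.- ℤ.+ b) ℤ.+ ℤ.+ b       ≡⟨ ℤ.+-assoc (ℤ.+ a) (ℤ.- (ℤ.+ b)) (ℤ.+ b) ⟩
  ℤ.+ a ℤ.+ (ℤ.- (ℤ.+ b) ℤ.+ ℤ.+ b) ≡⟨ cong (λ z → ℤ.+ a ℤ.+ z) (ℤ.+-inverseˡ (ℤ.+ b)) ⟩
  ℤ.+ a ℤ.+ ℤ.0ℤ                    ≡⟨ ℤ.+-identityʳ (ℤ.+ a) ⟩
  ℤ.+ a ∎)
  where open ≡-Reasoning

module SmoothCount {n : ℕ} (w x : Perm n) (x≤w : x ≤B w) where

  le : RankLe n (ext w) (ext x)
  le i j _ _ = proj₁ (≤B⇒raises x≤w) i j

  sv : SameValues n (ext x) (ext w)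
  sv j _ = sym (proj₂ (≤B⇒raises x≤w) j)

  open Admissible n (ext w) (λ u v → rank (ext x) u v ≡ rank (ext w) u v) (λ u v → rank (ext x) u v ≟ rank (ext w) u v)

  -- Inside its rectangle the exchange costs one unit of rank, so admissibility on the boxes of
  -- equality forces the rectangle to avoid them. There rk_x exceeds rk_w, and the loss can be
  -- afforded everywhere.
  inR : ∀ {c d} (c<n : c < n) (d<n : d < n) → c < d → ext x c < ext x d → Adm (sw c d (ext x)) → InR w x (fromℕ< c<n , fromℕ< d<n)
  inR {c} {d} c<n d<n c<d C<D ad = a<b , (x≤xt , x≉xt) , rankLe⇒≤B (suc (total n (ext (x ·t[ a , b ])))) (x ·t[ a , b ]) (x ·t[ a , b ]) w ≤-refl (≤B-refl λ _ → refl)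
      (λ i j i≤n j≤n → ≤-trans (sw-RankLe {y = ext x} c<d C<D le drop i j i≤n j≤n) (≤-reflexive (rank-cong i j λ k _ → sym (eq k))))
      (λ j j≤n → trans (rank-cong n j λ k _ → eq k) (sameValues-sw {y = ext x} {w = ext w} c<d d<n sv j j≤n))
    where
      a b : Fin n
      a = fromℕ< c<n
      b = fromℕ< d<n
      a≡ : toℕ a ≡ c
      a≡ = Fin.toℕ-fromℕ< c<n
      b≡ : toℕ b ≡ d
      b≡ = Fin.toℕ-fromℕ< d<n
      a<b : toℕ a < toℕ b
      a<b = subst₂ _<_ (sym a≡) (sym b≡) c<d
      A<B : ext x (toℕ a) < ext x (toℕ b)
      A<B = subst₂ (λ p q → ext x p < ext x q) (sym a≡) (sym b≡) C<D
      eq : ∀ k → ext (x ·t[ a , b ]) k ≡ sw c d (ext x) k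
      eq k = trans (ext-sw x a b k) (cong₂ (λ p q → sw p q (ext x) k) a≡ b≡)
      x≤xt : x ≤B (x ·t[ a , b ])
      x≤xt = ≤B-step a b (≤B-refl {x = x} {y = x} λ _ → refl) (len-up x a b a<b A<B) λ _ → refl
      x≉xt : ¬ (x ≈ (x ·t[ a , b ]))
      x≉xt h = <-irrefl (trans (ext-toℕ x a) (trans (cong toℕ (trans (h a) (cong (x ⟨$⟩ʳ_) (transpose-l a b)))) (sym (ext-toℕ x b)))) A<B
      drop : ∀ i j → i ≤ n → j ≤ n → c < i → i ≤ d → ext x c < j → j ≤ ext x d → rank (ext w) i j < rank (ext x) i j
      drop i j i≤n j≤n c<i i≤d C<j j≤D = ≤∧≢⇒< (le i j i≤n j≤n) λ w≡x → <-irrefl w≡x (subst (suc (rank (ext w) i j) ≤_)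
        (rank-sw-drop (ext x) i j c<i i≤d C<j j≤D) (s≤s (ad (s≤s i≤n) (s≤s j≤n) (sym w≡x))))

  -- An admissible cell is diagonal, an inversion of `x`, or, up to order, an element of R_τ. The
  -- total is at most n + 2 ℓ(x) + 2 #R_τ, which smoothness turns into n + 2 ℓ(w).
  few : Smooth w x → M (ext x) ≤ Total.M n (ext w) (ext w)
  few (k , (L , _ , L⇔R , refl) , k≡) = begin
    M (ext x) ≤⟨ sumTo-mono n (λ c c<n → sumTo-mono n λ d d<n → entry c d c<n d<n) ⟩
    square-sum n (λ c d → reflections (ext x) c d + (occ L c d + occ L d c)) ≡⟨ square-sum-+ n (reflections (ext x)) _ ⟩
    square-sum n (reflections (ext x)) + square-sum n (λ c d → occ L c d + occ L d c) ≡⟨ cong₂ _+_ (square-sum-reflections n (ext x))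
      (trans (square-sum-+ n (occ L) _) (cong₂ _+_ (square-sum-occ L) (trans (square-sum-flip n (occ L)) (square-sum-occ L)))) ⟩
    (n + (invs n (ext x) + invs n (ext x))) + (k + k) ≡⟨ +-assoc n _ _ ⟩
    n + ((invs n (ext x) + invs n (ext x)) + (k + k)) ≡⟨ cong (n +_) (+-interchange (invs n (ext x)) (invs n (ext x)) k k) ⟩
    n + ((invs n (ext x) + k) + (invs n (ext x) + k)) ≡⟨ cong (λ m → n + (m + m)) lengths ⟩
    n + (invs n (ext w) + invs n (ext w)) ≤⟨ reflections≤M n (ext w) ⟩
    Total.M n (ext w) (ext w) ∎
    where
      open ≤-Reasoning
      lengths : invs n (ext x) + k ≡ invs n (ext w)
      lengths = trans (cong (_+ k) (sym (len-invs x))) (trans (minus-shift {k} {len w} {len x} k≡) (len-invs w))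
      ordered : ∀ c d → c < n → d < n → c < d → 𝟙 (adm? (sw c d (ext x))) ≤ reflections (ext x) c d + (occ L c d + occ L d c)
      ordered c d c<n d<n c<d with <-cmp (ext x c) (ext x d)
      ... | tri≈ _ C≡D _ = ⊥-elim (<⇒≢ c<d (ext-injective x c d c<n d<n C≡D))
      ... | tri> _ _ D<C = ≤-trans (𝟙≤1 (adm? _)) (≤-trans (≤-reflexive (sym (trans (reflections-< (ext x) c<d) (lt-yes D<C)))) (m≤m+n (reflections (ext x) c d) _))
      ... | tri< C<D _ _ with adm? (sw c d (ext x))
      ...   | no _   = z≤n
      ...   | yes ad = ≤-trans (subst₂ (λ p q → 1 ≤ occ L p q) (Fin.toℕ-fromℕ< c<n) (Fin.toℕ-fromℕ< d<n)
                (occ-∈ (Equivalence.from (L⇔R _) (inR c<n d<n c<d C<D ad)))) (≤-trans (m≤m+n (occ L c d) (occ L d c)) (m≤n+m (occ L c d + occ L d c) (reflections (ext x) c d)))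
      -- The list `L` holds only pairs with first entry smaller, so both orders of (c , d) are
      -- looked up.
      entry : ∀ c d → c < n → d < n → 𝟙 (adm? (sw c d (ext x))) ≤ reflections (ext x) c d + (occ L c d + occ L d c)
      entry c d c<n d<n with <-cmp c d
      ... | tri< c<d _ _ = ordered c d c<n d<n c<d
      ... | tri≈ _ refl _ = ≤-trans (𝟙≤1 (adm? _)) (≤-trans (≤-reflexive (sym (reflections-≡ (ext x) c))) (m≤m+n (reflections (ext x) c c) _))
      ... | tri> _ _ d<c = ≤-trans (𝟙-mono (adm? _) (adm? _) (adm-cong′ (sw-comm c d (ext x)))) (≤-trans (ordered d c d<n c<n d<c)
                (≤-reflexive (cong₂ _+_ (reflections-sym (ext x) d c) (+-comm (occ L d c) _))))

-- Closure of the influence set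

sumFin-mono : ∀ {n} {f g : Fin n → ℕ} → (∀ u → f u ≤ g u) → sumFin f ≤ sumFin g
sumFin-mono {zero}  h = z≤n
sumFin-mono {suc n} h = +-mono-≤ (h fzero) (sumFin-mono (h ∘ fsuc))

sumFin-strict : ∀ {n} {f g : Fin n → ℕ} → (∀ u → f u ≤ g u) → ∀ u → f u < g u → sumFin f < sumFin g
sumFin-strict {suc n} h fzero    lt = +-mono-<-≤ lt (sumFin-mono (h ∘ fsuc))
sumFin-strict {suc n} h (fsuc u) lt = +-mono-≤-< (h fzero) (sumFin-strict (h ∘ fsuc) u lt)

module Saturation {n : ℕ} (w : Perm n) (A : Box n → Set) (A? : ∀ p → Dec (A p)) where

  step? : ∀ {B : Box n → Set} → (∀ p → Dec (B p)) → ∀ p → Dec (Step w A B p)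
  step? B? (i , j) = B? (i , j) ⊎-dec Decidable.map′ (λ (i′ , j′ , h) → (i′ , j′) , h) (λ ((i′ , j′) , h) → i′ , j′ , h)
    (Fin.any? λ i′ → Fin.any? λ j′ → A? (i′ , j′) ×-dec ((ℤ.0ℤ ℤ.<? _) ×-dec ((D w (i , j) (i′ , j′) ℤ.≟ ℤ.0ℤ) ×-dec (B? (i , j′) ×-dec B? (i′ , j)))))

  iter? : ∀ k p → Dec (Iter w A k p)
  iter? zero    = A?
  iter? (suc k) = step? (iter? k)

  size : ℕ → ℕ
  size k = sumFin {suc n} λ i → sumFin {suc n} λ j → 𝟙 (iter? k (i , j))

  sumFin-const : ∀ m c → sumFin {m} (λ _ → c) ≡ m * c
  sumFin-const zero    c = refl
  sumFin-const (suc m) c = cong (c +_) (sumFin-const m c)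

  size≤ : ∀ k → size k ≤ suc n * suc n
  size≤ k = ≤-trans (sumFin-mono λ i → ≤-trans (sumFin-mono λ j → 𝟙≤1 (iter? k (i , j))) (≤-reflexive (trans (sumFin-const (suc n) 1) (*-identityʳ (suc n)))))
    (≤-reflexive (sumFin-const (suc n) (suc n)))

  size-grows : ∀ k p → Iter w A (suc k) p → ¬ Iter w A k p → size k < size (suc k)
  size-grows k (i , j) h ¬h = sumFin-strict (λ i → sumFin-mono λ j → cell (i , j)) i (sumFin-strict (λ j → cell (i , j)) j
      (subst₂ _<_ (sym (𝟙-no (iter? k (i , j)) ¬h)) (sym (𝟙-yes (iter? (suc k) (i , j)) h)) z<s))
    where
      cell : ∀ p → 𝟙 (iter? k p) ≤ 𝟙 (iter? (suc k) p)
      cell p = 𝟙-mono (iter? k p) (iter? (suc k) p) inj₁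

  -- An iterate that is not yet closed grows by at least one box, and there are only (n + 1)² boxes;
  -- fuel exceeding the number of missing boxes suffices.
  saturate : ∀ fuel k → suc n * suc n < fuel + size k → ∃ λ k → ∀ p → Iter w A (suc k) p → Iter w A k p
  saturate zero       k h = ⊥-elim (<⇒≱ h (size≤ k))
  saturate (suc fuel) k h = case Fin.any? (λ i → Fin.any? (λ j → iter? (suc k) (i , j) ×-dec ¬? (iter? k (i , j)))) of λ
    { (no none) → k , λ { (i , j) h → decidable-stable (iter? k (i , j)) λ ¬h → none (i , j , h , ¬h) }
    ; (yes (i , j , new , ¬old)) → saturate fuel (suc k) (<-≤-trans h (≤-trans (≤-reflexive (sym (+-suc fuel (size k)))) (+-monoʳ-≤ fuel (size-grows k (i , j) new ¬old)))) }

  iter-start : ∀ k {p} → A p → Iter w A k p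
  iter-start zero    a = a
  iter-start (suc k) a = inj₁ (iter-start k a)

-- Integer differences are brought into constructor form so that the sign of their product in
-- `bowtie` is found by computation.
difference : ∀ {m n} → m < n → ∃ λ d → (ℤ.+ n ℤ.- ℤ.+ m ≡ ℤ.+[1+ d ]) × (ℤ.+ m ℤ.- ℤ.+ n ≡ ℤ.-[1+ d ])
difference {m} {n} m<n with m≤n⇒∃[o]m+o≡n m<n
... | d , refl = d
  , trans (ℤ.m-n≡m⊖n (suc m + d) m) (trans (ℤ.⊖-≥ (<⇒≤ m<n)) (cong ℤ.+_ gap))
  , trans (ℤ.m-n≡m⊖n m (suc m + d)) (trans (ℤ.⊖-< m<n) (cong (λ k → ℤ.- (ℤ.+ k)) gap))
  where
    gap : suc m + d ∸ m ≡ suc d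
    gap = trans (cong (_∸ m) (sym (+-suc m d))) (m+n∸m≡n m (suc d))

bowtie : ∀ {n} (i j i′ j′ : Fin (suc n)) → (toℕ i′ < toℕ i × toℕ j′ < toℕ j) ⊎ (toℕ i < toℕ i′ × toℕ j < toℕ j′) → (i , j) ⋈ (i′ , j′)
bowtie i j i′ j′ (inj₁ (p , q)) = subst₂ (λ a b → ℤ.0ℤ ℤ.< a ℤ.* b) (sym (proj₂ (proj₂ (difference p)))) (sym (proj₂ (proj₂ (difference q)))) (ℤ.+<+ z<s)
bowtie i j i′ j′ (inj₂ (p , q)) = subst₂ (λ a b → ℤ.0ℤ ℤ.< a ℤ.* b) (sym (proj₁ (proj₂ (difference p)))) (sym (proj₁ (proj₂ (difference q)))) (ℤ.+<+ z<s)

balanced : ∀ {p q r s} → p + q ≡ r + s → ((ℤ.+ p ℤ.+ ℤ.+ q) ℤ.- ℤ.+ r) ℤ.- ℤ.+ s ≡ ℤ.0ℤ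
balanced {p} {q} {r} {s} eq = begin
  ((ℤ.+ p ℤ.+ ℤ.+ q) ℤ.- ℤ.+ r) ℤ.- ℤ.+ s              ≡⟨ ℤ.+-assoc (ℤ.+ (p + q)) (ℤ.- (ℤ.+ r)) (ℤ.- (ℤ.+ s)) ⟩
  ℤ.+ (p + q) ℤ.+ (ℤ.- (ℤ.+ r) ℤ.+ ℤ.- (ℤ.+ s))        ≡⟨ cong (λ z → ℤ.+ (p + q) ℤ.+ z) (sym (ℤ.neg-distrib-+ (ℤ.+ r) (ℤ.+ s))) ⟩
  ℤ.+ (p + q) ℤ.- ℤ.+ (r + s)                          ≡⟨ ℤ.i≡j⇒i-j≡0 (cong ℤ.+_ eq) ⟩
  ℤ.0ℤ ∎
  where open ≡-Reasoning

X? : ∀ {n} (w x : Perm n) p → Dec (X w x p)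
X? w x p = (ℤ.+ rkB x p) ℤ.- (ℤ.+ rkB w p) ℤ.≟ ℤ.0ℤ

closed⇒everything : ∀ {n} (w x : Perm n) → x ≤B w → Smooth w x
                  → ∀ k → (∀ p → Iter w (X w x) (suc k) p → Iter w (X w x) k p) → ∀ p → Iter w (X w x) k p
closed⇒everything {n} w x x≤w smooth k closed (i , j) = subst₂ (λ a b → Iter w (X w x) k (a , b)) (Fin.fromℕ<-toℕ i _) (Fin.fromℕ<-toℕ j _)
    (Closed.everything n (ext w) (ext x) (ext-bounded w) (ext-bounded x) (SmoothCount.le w x x≤w) (SmoothCount.sv w x x≤w)
      J J? X⇒J rule (SmoothCount.few w x x≤w smooth) (toℕ i) (toℕ j) (≤-pred (Fin.toℕ<n i)) (≤-pred (Fin.toℕ<n j)) (Fin.toℕ<n i) (Fin.toℕ<n j))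
  where
    open Saturation w (X w x) (X? w x)
    -- Quantifying over the bounds makes `J` a predicate on all of ℕ × ℕ that is vacuously true off
    -- the grid and independent of the chosen proofs.
    J : ℕ → ℕ → Set
    J u v = (hu : u < suc n) (hv : v < suc n) → Iter w (X w x) k (fromℕ< hu , fromℕ< hv)
    J? : ∀ u v → Dec (J u v)
    J? u v with u <? suc n | v <? suc n
    ... | no u≮  | _      = yes λ hu → ⊥-elim (u≮ hu)
    ... | yes _  | no v≮  = yes λ _ hv → ⊥-elim (v≮ hv)
    ... | yes hu | yes hv = Decidable.map′ (λ h _ _ → h) (λ h → h hu hv) (iter? k (fromℕ< hu , fromℕ< hv))
    rank-at : ∀ (z : Perm n) {u v} (hu : u < suc n) (hv : v < suc n) → rkB z (fromℕ< hu , fromℕ< hv) ≡ rank (ext z) u v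
    rank-at z {u} {v} hu hv = trans (cong₂ (rk z) (Fin.toℕ-fromℕ< hu) (Fin.toℕ-fromℕ< hv)) (rk-rank z v (≤-pred hu))
    X-at : ∀ {u v} (hu : u < suc n) (hv : v < suc n) → rank (ext x) u v ≡ rank (ext w) u v → X w x (fromℕ< hu , fromℕ< hv)
    X-at hu hv eq = ℤ.i≡j⇒i-j≡0 (cong ℤ.+_ (trans (rank-at x hu hv) (trans eq (sym (rank-at w hu hv)))))
    X⇒J : ∀ u v → u ≤ n → v ≤ n → rank (ext x) u v ≡ rank (ext w) u v → J u v
    X⇒J u v _ _ eq hu hv = iter-start k (X-at hu hv eq)
    rule : ∀ u v u′ v′ → u ≤ n → v ≤ n → u′ ≤ n → v′ ≤ n → (u′ < u × v′ < v) ⊎ (u < u′ × v < v′)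
         → rank (ext x) u′ v′ ≡ rank (ext w) u′ v′ → J u v′ → J u′ v
         → rank (ext w) u v + rank (ext w) u′ v′ ≡ rank (ext w) u v′ + rank (ext w) u′ v → J u v
    rule u v u′ v′ u≤n v≤n u′≤n v′≤n order eqX J₁ J₂ eqD hu hv = closed _ (inj₂ ((fromℕ< hu′ , fromℕ< hv′) , X-at hu′ hv′ eqX ,
        bowtie (fromℕ< hu) (fromℕ< hv) (fromℕ< hu′) (fromℕ< hv′) order′ ,
        balanced {rkB w (fromℕ< hu , fromℕ< hv)} {rkB w (fromℕ< hu′ , fromℕ< hv′)} {rkB w (fromℕ< hu , fromℕ< hv′)} {rkB w (fromℕ< hu′ , fromℕ< hv)}
          (trans (cong₂ _+_ (rank-at w hu hv) (rank-at w hu′ hv′)) (trans eqD (sym (cong₂ _+_ (rank-at w hu hv′) (rank-at w hu′ hv))))) ,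
        J₁ hu hv′ , J₂ hu′ hv))
      where
        hu′ = s≤s u′≤n
        hv′ = s≤s v′≤n
        lower : ∀ {a b} (ha : a < suc n) (hb : b < suc n) → a < b → toℕ (fromℕ< ha) < toℕ (fromℕ< hb)
        lower ha hb = subst₂ _<_ (sym (Fin.toℕ-fromℕ< ha)) (sym (Fin.toℕ-fromℕ< hb))
        order′ : _ ⊎ _
        order′ = case order of λ
          { (inj₁ (p , q)) → inj₁ (lower hu′ hu p , lower hv′ hv q)
          ; (inj₂ (p , q)) → inj₂ (lower hu hu′ p , lower hv hv′ q) }

theorem2p8 : (n : ℕ) (w x : Perm n) → x ≤B w → Smooth w x → Influential w x
theorem2p8 n w x x≤w smooth p = case Saturation.saturate w (X w x) (X? w x) (suc (suc n * suc n)) 0 (m≤m+n _ _) of λ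
  { (k , closed) → k , closed⇒everything w x x≤w smooth k closed p }
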